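{- Let $p$ be a prime, $q=p^f$ with $f\ge1$, let $k\mid q-1$, and let $A_k=\{x^k:x\in\mathbb{F}_q^\times\}<\mathbb{F}_q^\times$ satisfy $\mathbb{F}_p(A_k)=\mathbb{F}_q$, with $k\ge3$ and $t=|A_k|=(q-1)/k\ge5$. Then $$r_{A_k+A_k}(c)<\frac t2\qquad\text{for every } c\in\mathbb{F}_q^\times.$$
   Context: For $A\subseteq\mathbb{F}_q$ and $c\in\mathbb{F}_q$, $r_{A+A}(c)=\#\{(x,y)\in A^2: x+y=c\}$ (ordered pairs). $\mathbb{F}_p(A_k)$ denotes the smallest subfield of $\mathbb{F}_q$ containing $A_k$. $A_k$ is the unique subgroup of index $k$ in $\mathbb{F}_q^\times$. -}

module Defs where

open import Level using (Level; _⊔_) renaming (suc to lsuc)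
open import Algebra.Apartness.Bundles using (HeytingField; HeytingCommutativeRing)
open import Algebra.Bundles using (CommutativeRing)
open import Data.Fin.Base using (Fin)
import Data.Fin.Properties as Fin
open import Data.List.Base using (List; allFin; cartesianProduct; filter; length; map)
open import Data.Nat.Base using (ℕ)
open import Data.Product.Base using (∃; _×_; _,_)
open import Function.Bundles using (Inverse)
open import Function.Construct.Symmetry using () renaming (inverse to symInverse)
open import Function.Properties.Inverse using (Inverse⇒Injection)
open import Relation.Binary.Definitions using (_Respects_)
  renaming (Decidable to Decidable₂)
open import Relation.Binary.PropositionalEquality using (_≡_)
import Relation.Binary.PropositionalEquality.Properties as ≡
open import Relation.Nullary.Decidable using (map′; ¬?; _×-dec_; via-injection)
open import Relation.Nullary.Negation using (¬_)
open import Relation.Unary using (Pred; Decidable; _∈_; _⊆_)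

-- A model of F_q. For a finite carrier, ≈ is decidable and the apartness of a
-- Heyting field coincides with ≉, so this is a field in the usual sense.
record FiniteField (a ℓ₁ ℓ₂ : Level) (q : ℕ) : Set (lsuc (a ⊔ ℓ₁ ⊔ ℓ₂)) where
  field
    heytingField : HeytingField a ℓ₁ ℓ₂

  commutativeRing : CommutativeRing a ℓ₁
  commutativeRing = HeytingCommutativeRing.commutativeRing
                      (HeytingField.heytingCommutativeRing heytingField)

  open CommutativeRing commutativeRing public

  field
    enumeration : Inverse (≡.setoid (Fin q)) setoid

  open import Algebra.Properties.Semiring.Exp semiring public using (_^_)

  open Inverse enumeration using ()
    renaming (to to element; from to index; strictlyInverseˡ to element-index)

  infix 4 _≟_
  _≟_ : Decidable₂ _≈_
  _≟_ = via-injection (Inverse⇒Injection (symInverse enumeration)) Fin._≟_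

  elements : List Carrier
  elements = map element (allFin q)

  ∣_∣ : ∀ {ℓ} {A : Pred Carrier ℓ} → Decidable A → ℕ
  ∣ A? ∣ = length (filter A? elements)

  -- r A? c is r_{A+A}(c): ordered pairs (x , y) are counted.
  r : ∀ {ℓ} {A : Pred Carrier ℓ} → Decidable A → Carrier → ℕ
  r A? c = length (filter (λ (x , y) → (A? x ×-dec A? y) ×-dec (x + y ≟ c))
                          (cartesianProduct elements elements))

  Powers : ℕ → Pred Carrier (a ⊔ ℓ₁)
  Powers k x = ∃ λ y → ¬ (y ≈ 0#) × y ^ k ≈ x

  powers? : ∀ k → Decidable (Powers k)
  powers? k x =
    map′ (λ (i , nz , eq) → element i , nz , eq)
         (λ (y , nz , eq) → index y
                          , (λ z → nz (trans (sym (element-index y)) z))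
                          , trans (^-congˡ k (element-index y)) eq)
         (Fin.any? λ i → ¬? (element i ≟ 0#) ×-dec (element i ^ k ≟ x))
    where open import Algebra.Properties.Semiring.Exp semiring using (^-congˡ)

  record IsSubfield {ℓ} (K : Pred Carrier ℓ) : Set (a ⊔ ℓ₁ ⊔ ℓ) where
    field
      resp-≈    : K Respects _≈_
      0#-closed : 0# ∈ K
      1#-closed : 1# ∈ K
      +-closed  : ∀ {x y} → x ∈ K → y ∈ K → x + y ∈ K
      neg-closed : ∀ {x} → x ∈ K → - x ∈ K
      *-closed  : ∀ {x y} → x ∈ K → y ∈ K → x * y ∈ K
      inv-closed : ∀ {x y} → x ∈ K → x * y ≈ 1# → y ∈ K

  -- F_p(A). Every subfield contains the prime field, so F_p needs no generators.
  data Adjoin {ℓ} (A : Pred Carrier ℓ) : Pred Carrier (a ⊔ ℓ₁ ⊔ ℓ) where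
    gen  : ∀ {x} → x ∈ A → x ∈ Adjoin A
    resp : ∀ {x y} → x ≈ y → x ∈ Adjoin A → y ∈ Adjoin A
    zer  : 0# ∈ Adjoin A
    one  : 1# ∈ Adjoin A
    add  : ∀ {x y} → x ∈ Adjoin A → y ∈ Adjoin A → x + y ∈ Adjoin A
    neg  : ∀ {x} → x ∈ Adjoin A → - x ∈ Adjoin A
    mul  : ∀ {x y} → x ∈ Adjoin A → y ∈ Adjoin A → x * y ∈ Adjoin A
    inv  : ∀ {x y} → x ∈ Adjoin A → x * y ≈ 1# → y ∈ Adjoin A

  Adjoin-isSubfield : ∀ {ℓ} (A : Pred Carrier ℓ) → IsSubfield (Adjoin A)
  Adjoin-isSubfield A = record
    { resp-≈ = resp ; 0#-closed = zer ; 1#-closed = one ; +-closed = add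
    ; neg-closed = neg ; *-closed = mul ; inv-closed = inv }

  Adjoin-least : ∀ {ℓ ℓ′} {A : Pred Carrier ℓ} {K : Pred Carrier ℓ′} →
                 IsSubfield K → A ⊆ K → Adjoin A ⊆ K
  Adjoin-least {A = A} {K} K-sub A⊆K = go
    where
    open IsSubfield K-sub
    go : Adjoin A ⊆ K
    go (gen x∈A)    = A⊆K x∈A
    go (resp x≈y d) = resp-≈ x≈y (go d)
    go zer          = 0#-closed
    go one          = 1#-closed
    go (add d e)    = +-closed (go d) (go e)
    go (neg d)      = neg-closed (go d)
    go (mul d e)    = *-closed (go d) (go e)
    go (inv d xy≈1) = inv-closed (go d) xy≈1

{-# OPTIONS --safe #-}

-- Let A be the subgroup, t its order, n = t + 1, and let T be the set of the x ∈ A with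
-- c - x ∈ A, so that |T| = r(c). Every point of T is a double root of
-- P = Xⁿ + (c - X)ⁿ - c, whose degree is at most 2⌈t/2⌉. If 2|T| ≥ t, then P = α G² with
-- G = ∏_{x ∈ T} (X - x).
--
-- Suppose that p ∤ n; also p ∤ t, as t ∣ q - 1. Comparing the expansions of
-- P and α G² to third order at the points of T gives C(n,2) X (c - X) G″ + C(n,3) (2X - c) G′ = λ G.
-- Each x = c/(1 + z) with z ∈ A and z ≠ ±1 is a zero of P′, and P ≠ 0 has too few double roots for
-- all of these to be zeros of P. At one that is not, G′ vanishes, and the same expansions with the
-- derivative of the equation give C(n,2) + 2 C(n,3) = 0 in F_p. As
-- 6 (C(n,2) + 2 C(n,3)) = n t (2t + 1), this forces p ∣ 2t + 1, and even 9 ∣ 2t + 1 when p = 3.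
--
-- If p divides N = n or N = 2t + 1, write N = M m with M a power of p and p ∤ m. On A we
-- have x^N = x, so u = x^M satisfies u^m + (c^M - u)^m = c for each x ∈ T. There are too many such
-- u unless m = 1; but then A is fixed by the additive map x ↦ x^M, so F_p(A) = F_q has at most
-- M ≤ 2t + 1 elements, whereas q - 1 = k t ≥ 3t.

module Submission where

open import Defs
open import Algebra.Apartness.Bundles using (HeytingField)
open import Algebra.Bundles using (CommutativeRing)
open import Algebra.Solver.Ring.AlmostCommutativeRing using (fromCommutativeRing; _-Raw-AlmostCommutative⟶_)
import Algebra.Solver.Ring
open import Data.Fin.Base using (Fin; zero; suc; toℕ; fromℕ; inject₁; punchIn)
open import Data.Fin.Permutation using (Permutation′; permutation)
import Data.Fin.Properties as Fin
open import Data.Integer.Base as ℤ using (ℤ; +_; -[1+_]; _⊖_)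
import Data.Integer.Properties as ℤ
open import Data.List.Base as List using (List; []; _∷_; length)
import Data.List.Properties as List
open import Data.List.Relation.Unary.All as All using (All; []; _∷_)
import Data.List.Relation.Unary.All.Properties as All
open import Data.List.Relation.Unary.AllPairs as AllPairs using (AllPairs; []; _∷_)
import Data.List.Relation.Unary.AllPairs.Properties as AllPairs
open import Data.List.Relation.Unary.Any as Any using (Any; here; there)
import Data.List.Relation.Unary.Any.Properties as Any
import Data.List.Relation.Unary.Unique.Propositional.Properties as Unique
import Data.List.Relation.Unary.Unique.Setoid.Properties as UniqueSetoid
import Data.Maybe.Base as Maybe
open import Data.Nat as ℕ using (ℕ; zero; suc; pred; z≤n; s≤s; _≤_; _<_; _∸_)
open import Data.Nat.Combinatorics using (_C_; nC1≡n; nCn≡1; nCk+nC[k+1]≡[n+1]C[k+1])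
open import Data.Nat.Coprimality using (Coprime; coprime-Bézout)
open import Data.Nat.Divisibility using (_∣_; divides; _∣?_; ∣⇒≤; ∣m⇒∣m*n; ∣n⇒∣m*n; ∣m+n∣m⇒∣n; ∣1⇒≡1; m∣m*n; n∣m*n)
open import Data.Nat.GCD using (module Bézout)
open import Data.Nat.Induction using (<-rec)
open import Data.Nat.Primality using (Prime; ¬prime[0]; euclidsLemma; prime⇒irreducible; prime⇒nonTrivial; prime⇒nonZero; prime?)
import Data.Nat.Properties as ℕ
open import Data.Nat.Solver using (module +-*-Solver)
open import Data.Product.Base using (∃; _×_; _,_; proj₁; proj₂)
open import Data.Sum.Base using (_⊎_; inj₁; inj₂)
open import Data.Vec.Base as Vec using (Vec; []; _∷_)
open import Data.Vec.Functional using (removeAt; replicate)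
open import Function.Base using (_∘_; id)
open import Function.Bundles using (Inverse)
import Level
open import Relation.Binary.PropositionalEquality as ≡ using (_≡_)
open import Relation.Nullary using (¬_; yes; no; contradiction)
open import Relation.Nullary.Decidable using (dec⇒maybe; ¬?; _×-dec_; from-no; from-yes)
open import Relation.Unary using (Pred; Decidable; _∈_)

-- Binomial identities and p-parts of natural numbers.

-- The absorption identity, by induction through Pascal's rule; the product form avoids division in
-- ℕ.
[1+k]*[1+n]C[1+k]≡[1+n]*nCk : ∀ n k → suc k ℕ.* (suc n C suc k) ≡ suc n ℕ.* (n C k)
[1+k]*[1+n]C[1+k]≡[1+n]*nCk zero    zero    = ≡.refl
[1+k]*[1+n]C[1+k]≡[1+n]*nCk zero    (suc k) = ℕ.*-zeroʳ (2 ℕ.+ k)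
[1+k]*[1+n]C[1+k]≡[1+n]*nCk (suc n) zero    =
  ≡.trans (ℕ.*-identityˡ _) (≡.trans (nC1≡n (2 ℕ.+ n)) (≡.sym (ℕ.*-identityʳ (2 ℕ.+ n))))
[1+k]*[1+n]C[1+k]≡[1+n]*nCk (suc n) (suc k) = begin
  (2 ℕ.+ k) ℕ.* ((2 ℕ.+ n) C (2 ℕ.+ k))
    ≡⟨ ≡.cong ((2 ℕ.+ k) ℕ.*_) (nCk+nC[k+1]≡[n+1]C[k+1] (suc n) (suc k)) ⟨
  (2 ℕ.+ k) ℕ.* (x ℕ.+ suc n C (2 ℕ.+ k))
    ≡⟨ solve 3 (λ k x y → (con 2 :+ k) :* (x :+ y) := x :+ ((con 1 :+ k) :* x :+ (con 2 :+ k) :* y)) ≡.refl k x (suc n C (2 ℕ.+ k)) ⟩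
  x ℕ.+ (suc k ℕ.* x ℕ.+ (2 ℕ.+ k) ℕ.* (suc n C (2 ℕ.+ k)))
    ≡⟨ ≡.cong (x ℕ.+_) (≡.cong₂ ℕ._+_ ([1+k]*[1+n]C[1+k]≡[1+n]*nCk n k) ([1+k]*[1+n]C[1+k]≡[1+n]*nCk n (suc k))) ⟩
  x ℕ.+ (suc n ℕ.* (n C k) ℕ.+ suc n ℕ.* (n C suc k))
    ≡⟨ ≡.cong (x ℕ.+_) (ℕ.*-distribˡ-+ (suc n) (n C k) (n C suc k)) ⟨
  x ℕ.+ suc n ℕ.* (n C k ℕ.+ n C suc k)
    ≡⟨ ≡.cong (λ w → x ℕ.+ suc n ℕ.* w) (nCk+nC[k+1]≡[n+1]C[k+1] n k) ⟩
  (2 ℕ.+ n) ℕ.* x ∎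
  where
  open ≡.≡-Reasoning
  open +-*-Solver
  x = suc n C suc k

-- By absorption the prime p = n + 1 divides (k + 1) C(p, k + 1), and 0 < k + 1 < p.
prime∣C : ∀ {n k} → Prime (suc n) → k < n → suc n ∣ suc n C suc k
prime∣C {n} {k} p k<n
  with euclidsLemma (suc k) (suc n C suc k) p (divides (n C k) (≡.trans ([1+k]*[1+n]C[1+k]≡[1+n]*nCk n k) (ℕ.*-comm (suc n) (n C k))))
... | inj₁ p∣k = contradiction (∣⇒≤ p∣k) (ℕ.<⇒≱ (s≤s k<n))
... | inj₂ p∣C = p∣C

prime∤⇒coprime : ∀ {p m} → Prime p → ¬ p ∣ m → Coprime p m
prime∤⇒coprime p p∤m (d∣p , d∣m) with prime⇒irreducible p d∣p
... | inj₁ d≡1    = d≡1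
... | inj₂ ≡.refl = contradiction d∣m p∤m

prime-power-part : ∀ {p} → Prime p → ∀ n → 0 < n → ∃ λ s → ∃ λ m → n ≡ p ℕ.^ s ℕ.* m × ¬ p ∣ m
prime-power-part {p} pr = <-rec _ go
  where
  go : ∀ n → (∀ {n′} → n′ < n → 0 < n′ → ∃ λ s → ∃ λ m → n′ ≡ p ℕ.^ s ℕ.* m × ¬ p ∣ m) →
       0 < n → ∃ λ s → ∃ λ m → n ≡ p ℕ.^ s ℕ.* m × ¬ p ∣ m
  go n rec 0<n with p ∣? n
  ... | no p∤n = 0 , n , ≡.sym (ℕ.*-identityˡ n) , p∤n
  ... | yes (divides zero ≡.refl) = contradiction 0<n λ ()
  ... | yes (divides n′@(suc _) ≡.refl) =
    let (s , m , eq , p∤m) = rec (ℕ.m<m*n n′ p (ℕ.nonTrivial⇒n>1 p ⦃ prime⇒nonTrivial pr ⦄)) (s≤s z≤n) in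
    suc s , m , (begin
      n′ ℕ.* p                  ≡⟨ ℕ.*-comm n′ p ⟩
      p ℕ.* n′                  ≡⟨ ≡.cong (p ℕ.*_) eq ⟩
      p ℕ.* (p ℕ.^ s ℕ.* m)     ≡⟨ ℕ.*-assoc p (p ℕ.^ s) m ⟨
      p ℕ.* p ℕ.^ s ℕ.* m       ∎) , p∤m
    where open ≡.≡-Reasoning

2*[1+t]C2≡[1+t]*t : ∀ t → 2 ℕ.* (suc t C 2) ≡ suc t ℕ.* t
2*[1+t]C2≡[1+t]*t t = ≡.trans ([1+k]*[1+n]C[1+k]≡[1+n]*nCk t 1) (≡.cong (suc t ℕ.*_) (nC1≡n t))

-- C(t+1,2) + 2 C(t+1,3) = 1² + 2² + ⋯ + t².
6*[C2+2C3]≡[1+t]*t*[1+2t] : ∀ t → 6 ℕ.* (suc t C 2 ℕ.+ 2 ℕ.* (suc t C 3)) ≡ suc t ℕ.* t ℕ.* suc (2 ℕ.* t)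
6*[C2+2C3]≡[1+t]*t*[1+2t] zero    = ≡.refl
6*[C2+2C3]≡[1+t]*t*[1+2t] (suc t) = begin
  6 ℕ.* ((2 ℕ.+ t) C 2 ℕ.+ 2 ℕ.* ((2 ℕ.+ t) C 3))
    ≡⟨ ≡.cong₂ (λ w z → 6 ℕ.* (w ℕ.+ 2 ℕ.* z)) (nCk+nC[k+1]≡[n+1]C[k+1] (suc t) 1) (nCk+nC[k+1]≡[n+1]C[k+1] (suc t) 2) ⟨
  6 ℕ.* (suc t C 1 ℕ.+ x ℕ.+ 2 ℕ.* (x ℕ.+ y))
    ≡⟨ ≡.cong (λ w → 6 ℕ.* (w ℕ.+ x ℕ.+ 2 ℕ.* (x ℕ.+ y))) (nC1≡n (suc t)) ⟩
  6 ℕ.* (suc t ℕ.+ x ℕ.+ 2 ℕ.* (x ℕ.+ y))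
    ≡⟨ solve 3 (λ t x y → con 6 :* (con 1 :+ t :+ x :+ con 2 :* (x :+ y))
         := con 6 :* (con 1 :+ t) :+ con 6 :* (con 2 :* x) :+ con 6 :* (x :+ con 2 :* y)) ≡.refl t x y ⟩
  6 ℕ.* suc t ℕ.+ 6 ℕ.* (2 ℕ.* x) ℕ.+ 6 ℕ.* (x ℕ.+ 2 ℕ.* y)
    ≡⟨ ≡.cong₂ (λ w z → 6 ℕ.* suc t ℕ.+ 6 ℕ.* w ℕ.+ z) (2*[1+t]C2≡[1+t]*t t) (6*[C2+2C3]≡[1+t]*t*[1+2t] t) ⟩
  6 ℕ.* suc t ℕ.+ 6 ℕ.* (suc t ℕ.* t) ℕ.+ suc t ℕ.* t ℕ.* suc (2 ℕ.* t)
    ≡⟨ solve 1 (λ t → con 6 :* (con 1 :+ t) :+ con 6 :* ((con 1 :+ t) :* t) :+ (con 1 :+ t) :* t :* (con 1 :+ con 2 :* t)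
         := (con 2 :+ t) :* (con 1 :+ t) :* (con 1 :+ con 2 :* (con 1 :+ t))) ≡.refl t ⟩
  (2 ℕ.+ t) ℕ.* suc t ℕ.* suc (2 ℕ.* suc t) ∎
  where
  open ≡.≡-Reasoning
  open +-*-Solver
  x = suc t C 2
  y = suc t C 3

parity : ∀ n → (∃ λ j → n ≡ j ℕ.* 2) ⊎ (∃ λ j → n ≡ suc (j ℕ.* 2))
parity zero = inj₁ (0 , ≡.refl)
parity (suc n) with parity n
... | inj₁ (j , ≡.refl) = inj₂ (j , ≡.refl)
... | inj₂ (j , ≡.refl) = inj₁ (suc j , ≡.refl)

-- Inequalities between t, the number of solutions and the cofactors.

-- The hypotheses force l ≥ 3, hence t + 1 ≤ l + 3 ≤ 2 l. Here l counts the elements of A left after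
-- removing 1 and, if present, -1; their critical points are candidates for double roots of P.
1+t≤2l : ∀ {t} l → 5 ≤ t → t ≤ 2 ℕ.+ l → suc t ≤ l ℕ.* 2
1+t≤2l {t} l 5≤t t≤2+l = begin
  suc t       ≤⟨ s≤s t≤2+l ⟩
  3 ℕ.+ l     ≤⟨ ℕ.+-monoˡ-≤ l (ℕ.≤-pred (ℕ.≤-pred (ℕ.≤-trans 5≤t t≤2+l))) ⟩
  l ℕ.+ l     ≡⟨ solve 1 (λ l → l :+ l := l :* con 2) ≡.refl l ⟩
  l ℕ.* 2     ∎
  where
  open ℕ.≤-Reasoning
  open +-*-Solver

prime≥2 : ∀ {p} → Prime p → 2 ≤ p
prime≥2 {p} pr = ℕ.nonTrivial⇒n>1 p ⦃ prime⇒nonTrivial pr ⦄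

p≤p^s : ∀ {p s m n} → Prime p → n ≡ p ℕ.^ s ℕ.* m → ¬ p ∣ m → p ∣ n → p ≤ p ℕ.^ s
p≤p^s {p} {zero}  {m} pr ≡.refl p∤m p∣n = contradiction (≡.subst (p ∣_) (ℕ.*-identityˡ m) p∣n) p∤m
p≤p^s {p} {suc s} {m} pr ≡.refl p∤m p∣n = ℕ.m≤m*n p (p ℕ.^ s) ⦃ ℕ.m^n≢0 p s ⦃ prime⇒nonZero pr ⦄ ⦄

-- In this and the next two lemmas l is the number of solutions. For odd m the reduced polynomial
-- has degree at most m - 1, so m roots are enough to make it zero.
odd-cofactor-≤ : ∀ {t M m l} → suc t ≡ M ℕ.* m → 2 ≤ M → t ≤ l ℕ.* 2 → m ≤ l
odd-cofactor-≤ {t} {M} {m} {l} eq 2≤M t≤2l = ℕ.≤-pred (ℕ.*-cancelʳ-< 2 m (suc l) (begin-strict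
  m ℕ.* 2         ≡⟨ ℕ.*-comm m 2 ⟩
  2 ℕ.* m         ≤⟨ ℕ.*-monoˡ-≤ m 2≤M ⟩
  M ℕ.* m         ≡⟨ eq ⟨
  suc t           ≤⟨ s≤s t≤2l ⟩
  suc (l ℕ.* 2)   <⟨ ℕ.n<1+n _ ⟩
  suc l ℕ.* 2     ∎))
  where open ℕ.≤-Reasoning

-- For even m the reduced polynomial may have degree m, so m + 1 roots are required; M ≥ 3 pays for
-- the extra one.
even-cofactor-< : ∀ {t M m l} → suc t ≡ M ℕ.* m → 3 ≤ M → 2 ≤ m → t ≤ l ℕ.* 2 → m < l
even-cofactor-< {t} {M} {m} {l} eq 3≤M 2≤m t≤2l = ℕ.*-cancelʳ-< 2 m l (ℕ.≤-pred (begin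
  2 ℕ.+ m ℕ.* 2   ≤⟨ ℕ.+-monoˡ-≤ (m ℕ.* 2) 2≤m ⟩
  m ℕ.+ m ℕ.* 2   ≡⟨ solve 1 (λ m → m :+ m :* con 2 := con 3 :* m) ≡.refl m ⟩
  3 ℕ.* m         ≤⟨ ℕ.*-monoˡ-≤ m 3≤M ⟩
  M ℕ.* m         ≡⟨ eq ⟨
  suc t           ≤⟨ s≤s t≤2l ⟩
  suc (l ℕ.* 2)   ∎))
  where
  open ℕ.≤-Reasoning
  open +-*-Solver

-- 5 m ≤ 2 t + 1 ≤ 4 l + 1 < 5 (l + 1). With M = 3 one would only get m ≤ (4 l + 1) / 3.
cofactor-≤ : ∀ {t M m l} → suc (2 ℕ.* t) ≡ M ℕ.* m → 5 ≤ M → t ≤ l ℕ.* 2 → m ≤ l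
cofactor-≤ {t} {M} {m} {l} eq 5≤M t≤2l = ℕ.≤-pred (ℕ.*-cancelʳ-< 5 m (suc l) (begin-strict
  m ℕ.* 5                     ≡⟨ ℕ.*-comm m 5 ⟩
  5 ℕ.* m                     ≤⟨ ℕ.*-monoˡ-≤ m 5≤M ⟩
  M ℕ.* m                     ≡⟨ eq ⟨
  suc (2 ℕ.* t)               ≤⟨ s≤s (ℕ.*-monoʳ-≤ 2 t≤2l) ⟩
  suc (2 ℕ.* (l ℕ.* 2))       <⟨ s≤s (s≤s (ℕ.m≤m+n (2 ℕ.* (l ℕ.* 2)) (3 ℕ.+ l))) ⟩
  2 ℕ.+ (2 ℕ.* (l ℕ.* 2) ℕ.+ (3 ℕ.+ l)) ≡⟨ solve 1 (λ l → con 2 :+ (con 2 :* (l :* con 2) :+ (con 3 :+ l)) := con 5 :+ l :* con 5) ≡.refl l ⟩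
  suc l ℕ.* 5                 ∎))
  where
  open ℕ.≤-Reasoning
  open +-*-Solver

-- Cancelling one p leaves 6 v = x m, and p still divides the left side because p ∣ 6.
prime-divides-twice : ∀ {p x m v} → Prime p → p ∣ 6 → 6 ℕ.* (v ℕ.* p) ≡ x ℕ.* (p ℕ.* m) → p ∣ x ⊎ p ∣ m
prime-divides-twice {p} {x} {m} {v} pr p∣6 eq = euclidsLemma x m pr (≡.subst (p ∣_)
  (ℕ.*-cancelʳ-≡ (6 ℕ.* v) (x ℕ.* m) p ⦃ prime⇒nonZero pr ⦄ (begin
    6 ℕ.* v ℕ.* p       ≡⟨ ℕ.*-assoc 6 v p ⟩
    6 ℕ.* (v ℕ.* p)     ≡⟨ eq ⟩
    x ℕ.* (p ℕ.* m)     ≡⟨ ≡.cong (x ℕ.*_) (ℕ.*-comm p m) ⟩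
    x ℕ.* (m ℕ.* p)     ≡⟨ ℕ.*-assoc x m p ⟨
    x ℕ.* m ℕ.* p       ∎))
  (∣m⇒∣m*n v p∣6))
  where open ≡.≡-Reasoning

-- The factor 6 supplies a second 3, so 9 divides x y and hence y; this rules out s = 1, and 3²
-- already exceeds 5.
5≤3^s : ∀ {x y m v} s → ¬ 3 ∣ x → 6 ℕ.* (v ℕ.* 3) ≡ x ℕ.* y → y ≡ 3 ℕ.^ s ℕ.* m → ¬ 3 ∣ m → 3 ≤ 3 ℕ.^ s → 5 ≤ 3 ℕ.^ s
5≤3^s 0 _ _ _ _ (s≤s ())
5≤3^s {x} {y} {m} {v} 1 3∤x eq ≡.refl 3∤m _
  with prime-divides-twice {3} {x} {m} {v} (from-yes (prime? 3)) (divides 2 ≡.refl) eq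
... | inj₁ 3∣x = contradiction 3∣x 3∤x
... | inj₂ 3∣m = contradiction 3∣m 3∤m
5≤3^s (suc (suc s)) _ _ _ _ _ = ℕ.≤-trans (ℕ.m≤n+m 5 4) (ℕ.*-monoʳ-≤ 3 (ℕ.m≤m*n 3 (3 ℕ.^ s) ⦃ ℕ.m^n≢0 3 s ⦄))

-- To be applied with w = C(t+1,2) + 2 C(t+1,3), x = (t + 1) t and y = 2 t + 1. The prime p divides
-- y, and p ≥ 5 unless p = 3, where 9 ∣ y.
5≤p^s : ∀ {p x y s m w} → Prime p → ¬ p ≡ 2 → ¬ p ∣ x → p ∣ w →
        6 ℕ.* w ≡ x ℕ.* y → y ≡ p ℕ.^ s ℕ.* m → ¬ p ∣ m → 5 ≤ p ℕ.^ s
5≤p^s {p} {x} {y} {s} pr p≢2 p∤x p∣w eq y≡ p∤m with euclidsLemma x y pr (≡.subst (p ∣_) eq (∣n⇒∣m*n 6 p∣w))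
... | inj₁ p∣x = contradiction p∣x p∤x
... | inj₂ p∣y with p≤p^s {s = s} pr y≡ p∤m p∣y | p ℕ.≟ 3
5≤p^s {x = x} {s = s} {m} pr _ p∤x (divides v ≡.refl) eq y≡ p∤m | inj₂ _ | p≤ | yes ≡.refl = 5≤3^s {x} {m = m} {v} s p∤x eq y≡ p∤m p≤
5≤p^s pr p≢2 _ _ _ _ _ | inj₂ _ | p≤ | no p≢3 = ℕ.≤-trans
  (ℕ.≤∧≢⇒< (ℕ.≤∧≢⇒< (ℕ.≤∧≢⇒< (prime≥2 pr) (p≢2 ∘ ≡.sym)) (p≢3 ∘ ≡.sym)) λ { ≡.refl → from-no (prime? 4) pr }) p≤

1+2t-odd : ∀ t j M → ¬ suc (2 ℕ.* t) ≡ M ℕ.* (j ℕ.* 2)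
1+2t-odd t j M eq = contradiction (∣1⇒≡1 (∣m+n∣m⇒∣n {2} {2 ℕ.* t} {1}
  (≡.subst (2 ∣_) (≡.trans (≡.sym eq) (ℕ.+-comm 1 (2 ℕ.* t))) (∣n⇒∣m*n M (n∣m*n j)))
  (m∣m*n t))) λ ()

suc-pred : ∀ {n} → 0 < pred n → suc (pred n) ≡ n
suc-pred {suc n} _ = ≡.refl

-- A ring solver with integer coefficients.

module IntegerCoefficientSolver {c ℓ} (R : CommutativeRing c ℓ) where
  open CommutativeRing R
  open import Algebra.Properties.Ring ring
  open import Algebra.Properties.AbelianGroup +-abelianGroup using (⁻¹-∙-comm)
  open import Algebra.Properties.Semiring.Mult.TCOptimised semiring
    using (×-homo-+; ×1-homo-*; 1+×) renaming (_×_ to _·_)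
  open import Relation.Binary.Reasoning.Setoid setoid

  -- The canonical map from ℤ. With the optimised multiple `_·_`, 1 · 1# reduces to 1# and 2 · 1# to
  -- 1# + 1#, so numerals of the solver match the constants in the goals definitionally.
  fromℤ : ℤ → Carrier
  fromℤ (+ n)    = n · 1#
  fromℤ -[1+ n ] = - (suc n · 1#)

  fromℤ-⊖ : ∀ m n → fromℤ (m ⊖ n) ≈ m · 1# - n · 1#
  fromℤ-⊖ m       zero    = sym (trans (+-congˡ -0#≈0#) (+-identityʳ _))
  fromℤ-⊖ zero    (suc n) = sym (+-identityˡ _)
  fromℤ-⊖ (suc m) (suc n) = begin
    fromℤ (suc m ⊖ suc n)                ≡⟨ ≡.cong fromℤ (ℤ.[1+m]⊖[1+n]≡m⊖n m n) ⟩
    fromℤ (m ⊖ n)                        ≈⟨ fromℤ-⊖ m n ⟩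
    m · 1# - n · 1#                      ≈⟨ +-congʳ (+-identityˡ _) ⟨
    (0# + m · 1#) - n · 1#               ≈⟨ +-congʳ (+-congʳ (-‿inverseʳ 1#)) ⟨
    ((1# - 1#) + m · 1#) - n · 1#
      ≈⟨ +-congʳ (trans (+-assoc _ _ _) (trans (+-congˡ (+-comm _ _)) (sym (+-assoc _ _ _)))) ⟩
    ((1# + m · 1#) - 1#) - n · 1#        ≈⟨ +-assoc _ _ _ ⟩
    (1# + m · 1#) + (- 1# - n · 1#)      ≈⟨ +-congˡ (⁻¹-∙-comm _ _) ⟩
    (1# + m · 1#) - (1# + n · 1#)        ≈⟨ +-cong (1+× m 1#) (-‿cong (1+× n 1#)) ⟨
    suc m · 1# - suc n · 1#              ∎

  fromℤ-+ : ∀ i j → fromℤ (i ℤ.+ j) ≈ fromℤ i + fromℤ j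
  fromℤ-+ (+ m)    (+ n)    = ×-homo-+ 1# m n
  fromℤ-+ (+ m)    -[1+ n ] = fromℤ-⊖ m (suc n)
  fromℤ-+ -[1+ m ] (+ n)    = trans (fromℤ-⊖ n (suc m)) (+-comm _ _)
  fromℤ-+ -[1+ m ] -[1+ n ] = begin
    - (suc (suc (m ℕ.+ n)) · 1#)        ≡⟨ ≡.cong (λ k → - (k · 1#)) (≡.cong suc (≡.sym (ℕ.+-suc m n))) ⟩
    - ((suc m ℕ.+ suc n) · 1#)          ≈⟨ -‿cong (×-homo-+ 1# (suc m) (suc n)) ⟩
    - (suc m · 1# + suc n · 1#)         ≈⟨ ⁻¹-∙-comm _ _ ⟨
    - (suc m · 1#) - suc n · 1#         ∎

  fromℤ-neg : ∀ i → fromℤ (ℤ.- i) ≈ - fromℤ i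
  fromℤ-neg (+ zero)  = sym -0#≈0#
  fromℤ-neg (+ suc n) = refl
  fromℤ-neg -[1+ n ]  = sym (-‿involutive _)

  fromℤ-+* : ∀ m j → fromℤ (+ m ℤ.* j) ≈ fromℤ (+ m) * fromℤ j
  fromℤ-+* m (+ n) = begin
    fromℤ (+ m ℤ.* + n)   ≡⟨ ≡.cong fromℤ (ℤ.pos-* m n) ⟨
    (m ℕ.* n) · 1#        ≈⟨ ×1-homo-* m n ⟩
    m · 1# * n · 1#       ∎
  fromℤ-+* m -[1+ n ] = begin
    fromℤ (+ m ℤ.* -[1+ n ])        ≡⟨ ≡.cong fromℤ (ℤ.neg-distribʳ-* (+ m) (+ suc n)) ⟨
    fromℤ (ℤ.- (+ m ℤ.* + suc n))   ≈⟨ fromℤ-neg (+ m ℤ.* + suc n) ⟩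
    - fromℤ (+ m ℤ.* + suc n)       ≈⟨ -‿cong (fromℤ-+* m (+ suc n)) ⟩
    - (m · 1# * suc n · 1#)         ≈⟨ -‿distribʳ-* _ _ ⟩
    m · 1# * - (suc n · 1#)         ∎

  fromℤ-* : ∀ i j → fromℤ (i ℤ.* j) ≈ fromℤ i * fromℤ j
  fromℤ-* (+ m)    j = fromℤ-+* m j
  fromℤ-* -[1+ m ] j = begin
    fromℤ (-[1+ m ] ℤ.* j)          ≡⟨ ≡.cong fromℤ (ℤ.neg-distribˡ-* (+ suc m) j) ⟨
    fromℤ (ℤ.- (+ suc m ℤ.* j))     ≈⟨ fromℤ-neg (+ suc m ℤ.* j) ⟩
    - fromℤ (+ suc m ℤ.* j)         ≈⟨ -‿cong (fromℤ-+* (suc m) j) ⟩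
    - (suc m · 1# * fromℤ j)        ≈⟨ -‿distribˡ-* _ _ ⟩
    - (suc m · 1#) * fromℤ j        ∎

  fromℤ-morphism : ℤ.+-*-rawRing -Raw-AlmostCommutative⟶ fromCommutativeRing R
  fromℤ-morphism = record
    { ⟦_⟧ = fromℤ ; +-homo = fromℤ-+ ; *-homo = fromℤ-* ; -‿homo = fromℤ-neg
    ; 0-homo = refl ; 1-homo = refl }

  open Algebra.Solver.Ring ℤ.+-*-rawRing (fromCommutativeRing R) fromℤ-morphism
    (λ i j → Maybe.map (reflexive ∘ ≡.cong fromℤ) (dec⇒maybe (i ℤ.≟ j))) public
    using (solve; _:=_; _:+_; _:*_; _:-_; :-_; con; Polynomial)

  :0 :1 :2 :3 :6 : ∀ {n} → Polynomial n
  :0 = con (+ 0)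
  :1 = con (+ 1)
  :2 = con (+ 2)
  :3 = con (+ 3)
  :6 = con (+ 6)


-- Arithmetic in a finite field.

module FieldTheory {a ℓ₁ ℓ₂ q} (F : FiniteField a ℓ₁ ℓ₂ q) where
  open FiniteField F hiding (zero)
  open IntegerCoefficientSolver commutativeRing
  open import Algebra.Properties.Ring ring
  open import Algebra.Properties.Semiring.Exp semiring using (^-congˡ; ^-assocʳ)
  open import Algebra.Properties.CommutativeSemiring.Exp commutativeSemiring using (^-distrib-*)
  open import Algebra.Properties.Semiring.Mult.TCOptimised semiring
    using (×-homo-+; ×1-homo-*; 1+×; ×ᵤ≈×) renaming (_×_ to _·_)
  open import Relation.Binary.Reasoning.Setoid setoid
  open Inverse enumeration using ()
    renaming (to to element; from to index; strictlyInverseˡ to element-index;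
              strictlyInverseʳ to index-element; from-cong to index-cong)
  open HeytingField heytingField using (tight; #⇒invertible; invertible⇒#)
  open import Algebra.Properties.Semiring.Mult semiring using (×-congʳ; ×-assoc-*) renaming (_×_ to _·ᵤ_)
  import Algebra.Properties.CommutativeMonoid.Sum +-commutativeMonoid as Sum
  import Algebra.Properties.CommutativeMonoid.Sum *-commutativeMonoid as Product
  import Algebra.Properties.CommutativeSemiring.Binomial commutativeSemiring as Binomial

  x-y≈0⇒x≈y : ∀ {x y} → x - y ≈ 0# → x ≈ y
  x-y≈0⇒x≈y {x} {y} e = trans (solve 2 (λ x y → x := (x :- y) :+ y) refl x y) (trans (+-congʳ e) (+-identityˡ y))

  x≈y⇒x-y≈0 : ∀ {x y} → x ≈ y → x - y ≈ 0#
  x≈y⇒x-y≈0 {x} {y} e = trans (+-congʳ e) (-‿inverseʳ y)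

  1≉0 : ¬ 1# ≈ 0#
  1≉0 e = proj₂ (tight 1# 0#) e (invertible⇒#
    (1# , solve 0 (:1 :* (:1 :- :0) := :1) refl
        , solve 0 ((:1 :- :0) :* :1 := :1) refl))

  -- Apartness from 0# is only refutable from ≉, so the inverse is found by search.
  inverse : ∀ x → ¬ x ≈ 0# → ∃ λ y → x * y ≈ 1#
  inverse x x≉0 with Fin.any? (λ i → x * element i ≟ 1#)
  ... | yes (i , e) = element i , e
  ... | no ∄inv     = contradiction (proj₁ (tight x 0#) ¬x#0) x≉0
    where
    ¬x#0 = λ x#0 → let (y , _ , e) = #⇒invertible x#0 in
      ∄inv (index y , trans (*-congˡ (element-index y))
                        (trans (*-congʳ (solve 1 (λ x → x := x :- :0) refl x)) e))

  *-cancelˡ-≉0 : ∀ {x y z} → ¬ x ≈ 0# → x * y ≈ x * z → y ≈ z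
  *-cancelˡ-≉0 {x} {y} {z} x≉0 e = let (w , xw) = inverse x x≉0 in begin
    y             ≈⟨ *-identityˡ y ⟨
    1# * y        ≈⟨ *-congʳ xw ⟨
    (x * w) * y   ≈⟨ solve 3 (λ x w y → x :* w :* y := w :* (x :* y)) refl x w y ⟩
    w * (x * y)   ≈⟨ *-congˡ e ⟩
    w * (x * z)   ≈⟨ solve 3 (λ x w y → x :* w :* y := w :* (x :* y)) refl x w z ⟨
    (x * w) * z   ≈⟨ *-congʳ xw ⟩
    1# * z        ≈⟨ *-identityˡ z ⟩
    z             ∎

  xy≈0⇒y≈0 : ∀ {x y} → ¬ x ≈ 0# → x * y ≈ 0# → y ≈ 0#
  xy≈0⇒y≈0 x≉0 e = *-cancelˡ-≉0 x≉0 (trans e (sym (zeroʳ _)))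

  *-≉0 : ∀ {x y} → ¬ x ≈ 0# → ¬ y ≈ 0# → ¬ x * y ≈ 0#
  *-≉0 x≉0 y≉0 e = y≉0 (xy≈0⇒y≈0 x≉0 e)

  ^-≉0 : ∀ {x} n → ¬ x ≈ 0# → ¬ x ^ n ≈ 0#
  ^-≉0 zero    x≉0 = 1≉0
  ^-≉0 (suc n) x≉0 = *-≉0 x≉0 (^-≉0 n x≉0)

  1^n≈1 : ∀ n → 1# ^ n ≈ 1#
  1^n≈1 zero    = refl
  1^n≈1 (suc n) = trans (*-identityˡ _) (1^n≈1 n)

  -1^even≈1 : ∀ j → (- 1#) ^ (j ℕ.* 2) ≈ 1#
  -1^even≈1 zero    = refl
  -1^even≈1 (suc j) = begin
    - 1# * (- 1# * (- 1#) ^ (j ℕ.* 2))   ≈⟨ solve 1 (λ x → (:- :1) :* ((:- :1) :* x) := x) refl _ ⟩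
    (- 1#) ^ (j ℕ.* 2)                   ≈⟨ -1^even≈1 j ⟩
    1#                                   ∎

  -1^odd≈-1 : ∀ j → (- 1#) ^ suc (j ℕ.* 2) ≈ - 1#
  -1^odd≈-1 j = trans (*-congˡ (-1^even≈1 j)) (*-identityʳ _)

  -- Polynomials represented by their Taylor expansions at all points.

  ι : ℕ → Carrier
  ι n = n · 1#

  -- A sequence s stands for the power series Σ sᵢεⁱ; lin u v s is (u + vε) s.
  Seq : Set a
  Seq = ℕ → Carrier

  const : Carrier → Seq
  const x zero    = x
  const x (suc i) = 0#

  lin : Carrier → Carrier → Seq → Seq
  lin u v s zero    = u * s 0
  lin u v s (suc i) = u * s (suc i) + v * s i

  lin-cong : ∀ {u u′ v v′ s s′} → u ≈ u′ → v ≈ v′ → (∀ i → s i ≈ s′ i) →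
             ∀ i → lin u v s i ≈ lin u′ v′ s′ i
  lin-cong u v s zero    = *-cong u (s 0)
  lin-cong u v s (suc i) = +-cong (*-cong u (s (suc i))) (*-cong v (s i))

  -- taylor f x is the expansion of f(x + ε), f being given by its coefficients in
  -- increasing order of degree.
  taylor : ∀ {d} → Vec Carrier d → Carrier → Seq
  taylor []      x i = 0#
  taylor (b ∷ f) x i = const b i + lin x 1# (taylor f x) i

  -- The degree is less than d. Recording whole expansions φ x makes the Hasse derivatives
  -- available, which need no division by factorials and so behave well in small characteristic.
  Poly : ℕ → (Carrier → Seq) → Set _
  Poly d φ = ∃ λ (f : Vec Carrier d) → ∀ x i → taylor f x i ≈ φ x i

  Poly-resp : ∀ {d φ ψ} → (∀ x i → φ x i ≈ ψ x i) → Poly d φ → Poly d ψ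
  Poly-resp e (f , f≈) = f , λ x i → trans (f≈ x i) (e x i)

  Poly-const : ∀ b → Poly 1 (λ _ → const b)
  Poly-const b = (b ∷ []) , λ where
    x zero    → solve 2 (λ b x → b :+ x :* :0 := b) refl b x
    x (suc i) → solve 1 (λ x → :0 :+ (x :* :0 :+ :1 :* :0) := :0) refl x

  Poly-zero : ∀ d → Poly d (λ _ _ → 0#)
  Poly-zero zero    = [] , λ _ _ → refl
  Poly-zero (suc d) with Poly-zero d
  ... | f , f≈ = (0# ∷ f) , λ where
    x zero    → trans (+-congˡ (*-congˡ (f≈ x 0))) (solve 1 (λ x → :0 :+ x :* :0 := :0) refl x)
    x (suc i) → trans (+-congˡ (+-cong (*-congˡ (f≈ x (suc i))) (*-congˡ (f≈ x i))))
                  (solve 1 (λ x → :0 :+ (x :* :0 :+ :1 :* :0) := :0) refl x)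

  taylor-+ : ∀ {d} (f g : Vec Carrier d) x i →
             taylor (Vec.zipWith _+_ f g) x i ≈ taylor f x i + taylor g x i
  taylor-+ []      []      x i       = sym (+-identityˡ 0#)
  taylor-+ (b ∷ f) (c ∷ g) x zero    = trans (+-congˡ (*-congˡ (taylor-+ f g x 0)))
    (solve 5 (λ b c x s t → b :+ c :+ x :* (s :+ t) := b :+ x :* s :+ (c :+ x :* t)) refl b c x (taylor f x 0) (taylor g x 0))
  taylor-+ (b ∷ f) (c ∷ g) x (suc i) =
    trans (+-congˡ (+-cong (*-congˡ (taylor-+ f g x (suc i))) (*-congˡ (taylor-+ f g x i))))
      (solve 5 (λ x s t s′ t′ → :0 :+ (x :* (s :+ t) :+ :1 :* (s′ :+ t′))
                              := :0 :+ (x :* s :+ :1 :* s′) :+ (:0 :+ (x :* t :+ :1 :* t′)))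
        refl x (taylor f x (suc i)) (taylor g x (suc i)) (taylor f x i) (taylor g x i))

  Poly-+ : ∀ {d φ ψ} → Poly d φ → Poly d ψ → Poly d (λ x i → φ x i + ψ x i)
  Poly-+ (f , f≈) (g , g≈) = Vec.zipWith _+_ f g , λ x i → trans (taylor-+ f g x i) (+-cong (f≈ x i) (g≈ x i))

  taylor-* : ∀ {d} b (f : Vec Carrier d) x i → taylor (Vec.map (b *_) f) x i ≈ b * taylor f x i
  taylor-* b []      x i       = sym (zeroʳ b)
  taylor-* b (c ∷ f) x zero    = trans (+-congˡ (*-congˡ (taylor-* b f x 0)))
    (solve 4 (λ b c x s → b :* c :+ x :* (b :* s) := b :* (c :+ x :* s)) refl b c x (taylor f x 0))
  taylor-* b (c ∷ f) x (suc i) =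
    trans (+-congˡ (+-cong (*-congˡ (taylor-* b f x (suc i))) (*-congˡ (taylor-* b f x i))))
      (solve 4 (λ b x s t → :0 :+ (x :* (b :* s) :+ :1 :* (b :* t))
                         := b :* (:0 :+ (x :* s :+ :1 :* t))) refl b x (taylor f x (suc i)) (taylor f x i))

  Poly-scale : ∀ {d φ} b → Poly d φ → Poly d (λ x i → b * φ x i)
  Poly-scale b (f , f≈) = Vec.map (b *_) f , λ x i → trans (taylor-* b f x i) (*-congˡ (f≈ x i))

  Poly-X* : ∀ {d φ} → Poly d φ → Poly (suc d) (λ x → lin x 1# (φ x))
  Poly-X* (f , f≈) = (0# ∷ f) , λ where
    x zero    → trans (+-identityˡ _) (*-congˡ (f≈ x 0))
    x (suc i) → trans (+-identityˡ _) (+-cong (*-congˡ (f≈ x (suc i))) (*-congˡ (f≈ x i)))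

  taylor-pad : ∀ {d} (f : Vec Carrier d) → Poly (suc d) (taylor f)
  taylor-pad []      = Poly-zero 1
  taylor-pad (b ∷ f) with taylor-pad f
  ... | g , g≈ = (b ∷ g) , λ x i → +-congˡ (lin-cong refl refl (g≈ x) i)

  Poly-suc : ∀ {d φ} → Poly d φ → Poly (suc d) φ
  Poly-suc (f , f≈) = Poly-resp f≈ (taylor-pad f)

  Poly-≤ : ∀ {d e φ} → d ≤ e → Poly d φ → Poly e φ
  Poly-≤ d≤e = go (ℕ.≤⇒≤′ d≤e)
    where
    go : ∀ {d e φ} → d ℕ.≤′ e → Poly d φ → Poly e φ
    go ℕ.≤′-refl       P = P
    go (ℕ.≤′-step d≤e) P = Poly-suc (go d≤e P)

  -- Multiplication by u + v X, whose expansion at x is (u + v x) + v ε.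
  Poly-lin : ∀ {d φ} u v → Poly d φ → Poly (suc d) (λ x → lin (u + v * x) v (φ x))
  Poly-lin {φ = φ} u v P = Poly-resp
    (λ where
      x zero    → solve 4 (λ u v x s → u :* s :+ v :* (x :* s) := (u :+ v :* x) :* s) refl u v x (φ x 0)
      x (suc i) → solve 5 (λ u v x s t → u :* s :+ v :* (x :* s :+ :1 :* t) := (u :+ v :* x) :* s :+ v :* t)
                    refl u v x (φ x (suc i)) (φ x i))
    (Poly-+ (Poly-scale u (Poly-suc P)) (Poly-scale v (Poly-X* P)))

  derivative : Seq → Seq
  derivative s i = ι (suc i) * s (suc i)

  ι-suc : ∀ n → ι (suc n) ≈ 1# + ι n
  ι-suc n = 1+× n 1#

  -- Induction through (b + X f)′ = f + X f′; differentiating in ε agrees with differentiating in X.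
  taylor-derivative : ∀ {d} (f : Vec Carrier (suc d)) → Poly d (λ x → derivative (taylor f x))
  taylor-derivative {zero}  (b ∷ []) = [] , λ x i →
    solve 2 (λ x m → :0 := m :* (:0 :+ (x :* :0 :+ :1 :* :0))) refl x (ι (suc i))
  taylor-derivative {suc d} (b ∷ f) = Poly-resp eq
    (Poly-+ (f , λ _ _ → refl) (Poly-X* (taylor-derivative f)))
    where
    eq : ∀ x i → taylor f x i + lin x 1# (derivative (taylor f x)) i ≈ derivative (taylor (b ∷ f) x) i
    eq x zero    = solve 3 (λ x s t → s :+ x :* (:1 :* t) := :1 :* (:0 :+ (x :* t :+ :1 :* s)))
                     refl x (taylor f x 0) (taylor f x 1)
    eq x (suc i) = begin
      s₁ + (x * (ι (2 ℕ.+ i) * s₂) + 1# * (ι (suc i) * s₁))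
        ≈⟨ +-congˡ (+-congʳ (*-congˡ (*-congʳ (ι-suc (suc i))))) ⟩
      s₁ + (x * ((1# + ι (suc i)) * s₂) + 1# * (ι (suc i) * s₁))
        ≈⟨ solve 4 (λ x s t m → s :+ (x :* ((:1 :+ m) :* t) :+ :1 :* (m :* s))
             := (:1 :+ m) :* (:0 :+ (x :* t :+ :1 :* s))) refl x s₁ s₂ (ι (suc i)) ⟩
      (1# + ι (suc i)) * (0# + (x * s₂ + 1# * s₁))
        ≈⟨ *-congʳ (ι-suc (suc i)) ⟨
      ι (2 ℕ.+ i) * (0# + (x * s₂ + 1# * s₁))   ∎
      where
      s₁ = taylor f x (suc i)
      s₂ = taylor f x (2 ℕ.+ i)

  Poly-derivative : ∀ {d φ} → Poly (suc d) φ → Poly d (λ x → derivative (φ x))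
  Poly-derivative (f , f≈) = Poly-resp (λ x i → *-congˡ (f≈ x (suc i))) (taylor-derivative f)

  -- Division by roots and double roots.

  -- Horner's scheme: if f = β + (X - r) g with β = f(r), then b + X f = (b + r β) + (X - r) (β + X
  -- g).
  synthetic-division : ∀ {d} (f : Vec Carrier (suc d)) r → ∃ λ (g : Vec Carrier d) →
    ∀ x i → taylor f x i ≈ const (taylor f r 0) i + lin (x - r) 1# (taylor g x) i
  synthetic-division {zero} (b ∷ []) r = [] , λ where
    x zero    → solve 3 (λ b x r → b :+ x :* :0 := b :+ r :* :0 :+ (x :- r) :* :0) refl b x r
    x (suc i) → solve 2 (λ x r → :0 :+ (x :* :0 :+ :1 :* :0)
                              := :0 :+ ((x :- r) :* :0 :+ :1 :* :0)) refl x r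
  synthetic-division {suc d} (b ∷ f) r with synthetic-division f r
  ... | g , f≈ = (taylor f r 0 ∷ g) , λ where
    x zero          → trans (+-congˡ (*-congˡ (f≈ x 0)))
      (solve 5 (λ b x r β s → b :+ x :* (β :+ (x :- r) :* s) := b :+ r :* β :+ (x :- r) :* (β :+ x :* s))
        refl b x r (taylor f r 0) (taylor g x 0))
    x (suc zero)    → trans (+-congˡ (+-cong (*-congˡ (f≈ x 1)) (*-congˡ (f≈ x 0))))
      (solve 5 (λ x r β s t → :0 :+ (x :* (:0 :+ ((x :- r) :* t :+ :1 :* s)) :+ :1 :* (β :+ (x :- r) :* s))
                           := :0 :+ ((x :- r) :* (:0 :+ (x :* t :+ :1 :* s)) :+ :1 :* (β :+ x :* s)))
        refl x r (taylor f r 0) (taylor g x 0) (taylor g x 1))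
    x (suc (suc i)) → trans (+-congˡ (+-cong (*-congˡ (f≈ x (2 ℕ.+ i))) (*-congˡ (f≈ x (suc i)))))
      (solve 5 (λ x r s t w → :0 :+ (x :* (:0 :+ ((x :- r) :* w :+ :1 :* t)) :+ :1 :* (:0 :+ ((x :- r) :* t :+ :1 :* s)))
                           := :0 :+ ((x :- r) :* (:0 :+ (x :* w :+ :1 :* t)) :+ :1 :* (:0 :+ (x :* t :+ :1 :* s))))
        refl x r (taylor g x i) (taylor g x (suc i)) (taylor g x (2 ℕ.+ i)))

  divide-root : ∀ {d φ} r → Poly d φ → φ r 0 ≈ 0# →
                ∃ λ ψ → Poly (pred d) ψ × (∀ x i → φ x i ≈ lin (x - r) 1# (ψ x) i)
  divide-root {zero}  {φ} r ([] , f≈) e = (λ _ _ → 0#) , Poly-zero 0 , λ where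
    x zero    → trans (sym (f≈ x 0)) (sym (zeroʳ _))
    x (suc i) → trans (sym (f≈ x (suc i))) (solve 1 (λ u → :0 := u :* :0 :+ :1 :* :0) refl (x - r))
  divide-root {suc d} {φ} r (f , f≈) e with synthetic-division f r
  ... | g , f≈g = taylor g , (g , λ _ _ → refl) , λ where
    x zero    → trans (sym (f≈ x 0)) (trans (f≈g x 0) (trans (+-congʳ (trans (f≈ r 0) e)) (+-identityˡ _)))
    x (suc i) → trans (sym (f≈ x (suc i))) (trans (f≈g x (suc i)) (+-identityˡ _))

  Distinct : List Carrier → Set _
  Distinct = AllPairs (λ x y → ¬ x ≈ y)

  lin-zero : ∀ {u v s} → (∀ i → s i ≈ 0#) → ∀ i → lin u v s i ≈ 0#
  lin-zero {u}     s≈0 zero    = trans (*-congˡ (s≈0 0)) (zeroʳ u)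
  lin-zero {u} {v} s≈0 (suc i) = trans (+-cong (*-congˡ (s≈0 (suc i))) (*-congˡ (s≈0 i)))
    (solve 2 (λ u v → u :* :0 :+ v :* :0 := :0) refl u v)

  Root DoubleRoot : (Carrier → Seq) → Carrier → Set _
  Root φ x = φ x 0 ≈ 0#
  DoubleRoot φ x = φ x 0 ≈ 0# × φ x 1 ≈ 0#

  x≉y⇒y-x≉0 : ∀ {x y} → ¬ x ≈ y → ¬ y - x ≈ 0#
  x≉y⇒y-x≉0 x≉y e = x≉y (sym (x-y≈0⇒x≈y e))

  root-of-quotient : ∀ {φ ψ : Carrier → Seq} {r} → (∀ x i → φ x i ≈ lin (x - r) 1# (ψ x) i) →
                     ∀ {x} → ¬ r ≈ x → Root φ x → Root ψ x
  root-of-quotient φ≈ r≉x e = xy≈0⇒y≈0 (x≉y⇒y-x≉0 r≉x) (trans (sym (φ≈ _ 0)) e)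

  doubleRoot-of-quotient : ∀ {φ ψ : Carrier → Seq} {r} → (∀ x i → φ x i ≈ lin (x - r) 1# (ψ x) i) →
                           ∀ {x} → ¬ r ≈ x → DoubleRoot φ x → DoubleRoot ψ x
  doubleRoot-of-quotient {φ} {ψ} {r} φ≈ {x} r≉x (e₀ , e₁) = ψ₀ , xy≈0⇒y≈0 (x≉y⇒y-x≉0 r≉x) (begin
    (x - r) * ψ x 1               ≈⟨ solve 2 (λ u s → u :* s := u :* s :+ :1 :* :0) refl (x - r) (ψ x 1) ⟩
    (x - r) * ψ x 1 + 1# * 0#     ≈⟨ +-congˡ (*-congˡ ψ₀) ⟨
    (x - r) * ψ x 1 + 1# * ψ x 0  ≈⟨ φ≈ x 1 ⟨
    φ x 1                         ≈⟨ e₁ ⟩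
    0#                            ∎)
    where
    ψ₀ = root-of-quotient {φ} {ψ} φ≈ r≉x e₀

  -- If φ = (X - r) χ, the coefficient of ε in φ at r is χ(r); its vanishing permits the second
  -- division. The last component carries the remaining double roots over to the quotient.
  divide-doubleRoot : ∀ {d φ} r → Poly d φ → DoubleRoot φ r →
    ∃ λ ψ → Poly (pred (pred d)) ψ × (∀ x i → φ x i ≈ lin (x - r) 1# (lin (x - r) 1# (ψ x)) i)
          × (∀ {x} → ¬ r ≈ x → DoubleRoot φ x → DoubleRoot ψ x)
  divide-doubleRoot {φ = φ} r P (e₀ , e₁) with divide-root r P e₀
  ... | χ , Q , φ≈ with divide-root r Q χ₀
    where
    χ₀ : χ r 0 ≈ 0#
    χ₀ = begin
      χ r 0                          ≈⟨ solve 3 (λ r s t → s := (r :- r) :* t :+ :1 :* s) refl r (χ r 0) (χ r 1) ⟩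
      (r - r) * χ r 1 + 1# * χ r 0   ≈⟨ φ≈ r 1 ⟨
      φ r 1                          ≈⟨ e₁ ⟩
      0#                             ∎
  ... | ψ , R , χ≈ = ψ , R , (λ x i → trans (φ≈ x i) (lin-cong refl refl (χ≈ x) i)) ,
    λ r≉x → doubleRoot-of-quotient {χ} {ψ} χ≈ r≉x ∘ doubleRoot-of-quotient {φ} {χ} φ≈ r≉x

  quotient-roots : ∀ {p p′} {P : Carrier → Set p} {P′ : Carrier → Set p′} {r xs} →
    (∀ {x} → ¬ r ≈ x → P x → P′ x) → All (λ x → ¬ r ≈ x) xs → All P xs → All P′ xs
  quotient-roots step r∉xs Pxs = All.zipWith (λ (r≉x , Px) → step r≉x Px) (r∉xs , Pxs)

  many-roots⇒zero : ∀ {d φ} xs → Distinct xs → d ≤ length xs → Poly d φ → All (Root φ) xs →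
                    ∀ x i → φ x i ≈ 0#
  many-roots⇒zero [] _ z≤n ([] , f≈) _ x i = sym (f≈ x i)
  many-roots⇒zero {d} {φ} (r ∷ xs) (r∉xs ∷ xs!) d≤ P (e ∷ es) x i =
    let (ψ , Q , φ≈) = divide-root r P e in
    trans (φ≈ x i) (lin-zero
      (many-roots⇒zero {pred d} {ψ} xs xs! (ℕ.pred-mono-≤ d≤) Q (quotient-roots {P = Root φ} {Root ψ} (root-of-quotient {φ} {ψ} φ≈) r∉xs es) x) i)

  many-doubleRoots⇒zero : ∀ {d φ} xs → Distinct xs → d ≤ length xs ℕ.* 2 → Poly d φ → All (DoubleRoot φ) xs →
                          ∀ x i → φ x i ≈ 0#
  many-doubleRoots⇒zero [] _ z≤n ([] , f≈) _ x i = sym (f≈ x i)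
  many-doubleRoots⇒zero {d} {φ} (r ∷ xs) (r∉xs ∷ xs!) d≤ P (e ∷ es) x i =
    let (ψ , Q , φ≈ , step) = divide-doubleRoot r P e in
    trans (φ≈ x i) (lin-zero (lin-zero
      (many-doubleRoots⇒zero {pred (pred d)} {ψ} xs xs! (ℕ.pred-mono-≤ (ℕ.pred-mono-≤ d≤)) Q
        (quotient-roots {P = DoubleRoot φ} {DoubleRoot ψ} step r∉xs es) x)) i)

  -- Products of linear factors and their squares.

  ∏ : List Carrier → Carrier → Seq
  ∏ []       x = const 1#
  ∏ (r ∷ rs) x = lin (x - r) 1# (∏ rs x)

  -- The expansion of ∏ (X - r)², in the shape produced by repeated use of `divide-doubleRoot`.
  ∏² : List Carrier → Carrier → Seq
  ∏² []       x = const 1#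
  ∏² (r ∷ rs) x = lin (x - r) 1# (lin (x - r) 1# (∏² rs x))

  lin-* : ∀ b u v s i → lin u v (λ j → b * s j) i ≈ b * lin u v s i
  lin-* b u v s zero    = solve 3 (λ b u s → u :* (b :* s) := b :* (u :* s)) refl b u (s 0)
  lin-* b u v s (suc i) = solve 5 (λ b u v s t → u :* (b :* s) :+ v :* (b :* t) := b :* (u :* s :+ v :* t)) refl b u v (s (suc i)) (s i)

  Poly-1 : ∀ {d φ} → d ≤ 1 → Poly d φ → ∃ λ b → ∀ x i → φ x i ≈ b * const 1# i
  Poly-1 z≤n ([] , f≈) = 0# , λ x i → trans (sym (f≈ x i)) (sym (zeroˡ _))
  Poly-1 (s≤s z≤n) (b ∷ [] , f≈) = b , λ where
    x zero    → trans (sym (f≈ x 0)) (solve 2 (λ b x → b :+ x :* :0 := b :* :1) refl b x)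
    x (suc i) → trans (sym (f≈ x (suc i)))
      (solve 2 (λ b x → :0 :+ (x :* :0 :+ :1 :* :0) := b :* :0) refl b x)

  factor-roots : ∀ {d φ} xs → Distinct xs → d ≤ suc (length xs) → Poly d φ → All (Root φ) xs →
                 ∃ λ b → ∀ x i → φ x i ≈ b * ∏ xs x i
  factor-roots [] _ d≤ P _ = Poly-1 d≤ P
  factor-roots {d} {φ} (r ∷ xs) (r∉xs ∷ xs!) d≤ P (e ∷ es) =
    let (ψ , Q , φ≈) = divide-root r P e
        (b , ψ≈) = factor-roots {pred d} {ψ} xs xs! (ℕ.pred-mono-≤ d≤) Q
                     (quotient-roots {P = Root φ} {Root ψ} (root-of-quotient {φ} {ψ} φ≈) r∉xs es)
    in b , λ x i → trans (φ≈ x i) (trans (lin-cong refl refl (ψ≈ x) i) (lin-* b (x - r) 1# (∏ xs x) i))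

  factor-doubleRoots : ∀ {d φ} xs → Distinct xs → d ≤ suc (length xs ℕ.* 2) → Poly d φ → All (DoubleRoot φ) xs →
                       ∃ λ b → ∀ x i → φ x i ≈ b * ∏² xs x i
  factor-doubleRoots [] _ d≤ P _ = Poly-1 d≤ P
  factor-doubleRoots {d} {φ} (r ∷ xs) (r∉xs ∷ xs!) d≤ P (e ∷ es) =
    let (ψ , Q , φ≈ , step) = divide-doubleRoot r P e
        (b , ψ≈) = factor-doubleRoots {pred (pred d)} {ψ} xs xs! (ℕ.pred-mono-≤ (ℕ.pred-mono-≤ d≤)) Q
                     (quotient-roots {P = DoubleRoot φ} {DoubleRoot ψ} step r∉xs es)
    in b , λ x i → trans (φ≈ x i)
      (trans (lin-cong refl refl (λ j → trans (lin-cong refl refl (ψ≈ x) j) (lin-* b (x - r) 1# (∏² xs x) j)) i)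
             (lin-* b (x - r) 1# (lin (x - r) 1# (∏² xs x)) i))

  -- The square of a power series modulo ε⁴; the coefficients from ε⁴ on are set to 0#, and
  -- comparisons with `sq` are restricted to i < 4.
  sq : Seq → Seq
  sq s 0 = s 0 * s 0
  sq s 1 = (1# + 1#) * (s 0 * s 1)
  sq s 2 = (1# + 1#) * (s 0 * s 2) + s 1 * s 1
  sq s 3 = (1# + 1#) * (s 0 * s 3 + s 1 * s 2)
  sq s _ = 0#

  sq-lin : ∀ u s i → i < 4 → sq (lin u 1# s) i ≈ lin u 1# (lin u 1# (sq s)) i
  sq-lin u s 0 _ = solve 2 (λ u s₀ → (u :* s₀) :* (u :* s₀) := u :* (u :* (s₀ :* s₀))) refl u (s 0)
  sq-lin u s 1 _ = solve 3 (λ u s₀ s₁ →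
      :2 :* ((u :* s₀) :* (u :* s₁ :+ :1 :* s₀))
    := u :* (u :* (:2 :* (s₀ :* s₁)) :+ :1 :* (s₀ :* s₀)) :+ :1 :* (u :* (s₀ :* s₀)))
    refl u (s 0) (s 1)
  sq-lin u s 2 _ = solve 4 (λ u s₀ s₁ s₂ →
      :2 :* ((u :* s₀) :* (u :* s₂ :+ :1 :* s₁)) :+ (u :* s₁ :+ :1 :* s₀) :* (u :* s₁ :+ :1 :* s₀)
    := u :* (u :* (:2 :* (s₀ :* s₂) :+ s₁ :* s₁) :+ :1 :* (:2 :* (s₀ :* s₁)))
       :+ :1 :* (u :* (:2 :* (s₀ :* s₁)) :+ :1 :* (s₀ :* s₀)))
    refl u (s 0) (s 1) (s 2)
  sq-lin u s 3 _ = solve 5 (λ u s₀ s₁ s₂ s₃ →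
      :2 :* ((u :* s₀) :* (u :* s₃ :+ :1 :* s₂) :+ (u :* s₁ :+ :1 :* s₀) :* (u :* s₂ :+ :1 :* s₁))
    := u :* (u :* (:2 :* (s₀ :* s₃ :+ s₁ :* s₂)) :+ :1 :* (:2 :* (s₀ :* s₂) :+ s₁ :* s₁))
       :+ :1 :* (u :* (:2 :* (s₀ :* s₂) :+ s₁ :* s₁) :+ :1 :* (:2 :* (s₀ :* s₁))))
    refl u (s 0) (s 1) (s 2) (s 3)
  sq-lin u s (suc (suc (suc (suc i)))) (s≤s (s≤s (s≤s (s≤s ()))))

  lin-cong-< : ∀ {n u s t} → (∀ i → i < n → s i ≈ t i) → ∀ i → i < n → lin u 1# s i ≈ lin u 1# t i
  lin-cong-< e zero    i<n = *-congˡ (e 0 i<n)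
  lin-cong-< e (suc i) i<n = +-cong (*-congˡ (e (suc i) i<n)) (*-congˡ (e i (ℕ.<-trans (ℕ.n<1+n i) i<n)))

  ∏²≈sq∏ : ∀ rs x i → i < 4 → ∏² rs x i ≈ sq (∏ rs x) i
  ∏²≈sq∏ [] x 0 _ = sym (*-identityˡ 1#)
  ∏²≈sq∏ [] x 1 _ = solve 0 (:0 := :2 :* (:1 :* :0)) refl
  ∏²≈sq∏ [] x 2 _ = solve 0 (:0 := :2 :* (:1 :* :0) :+ :0 :* :0) refl
  ∏²≈sq∏ [] x 3 _ = solve 0 (:0 := :2 :* (:1 :* :0 :+ :0 :* :0)) refl
  ∏²≈sq∏ [] x (suc (suc (suc (suc i)))) (s≤s (s≤s (s≤s (s≤s ()))))
  ∏²≈sq∏ (r ∷ rs) x i i<4 = trans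
    (lin-cong-< (lin-cong-< (∏²≈sq∏ rs x)) i i<4) (sym (sq-lin (x - r) (∏ rs x) i i<4))

  -- Expansions of Xⁿ + (c - X)ⁿ - b.

  pow : Carrier → Carrier → ℕ → Seq
  pow u v zero    = const 1#
  pow u v (suc n) = lin u v (pow u v n)

  pow-0 : ∀ u v n → pow u v n 0 ≈ u ^ n
  pow-0 u v zero    = refl
  pow-0 u v (suc n) = *-congˡ (pow-0 u v n)

  pow-1 : ∀ u v n → pow u v (suc n) 1 ≈ ι (suc n) * (v * u ^ n)
  pow-1 u v zero    = solve 2 (λ u v → u :* :0 :+ v :* :1 := :1 :* (v :* :1)) refl u v
  pow-1 u v (suc n) = begin
    u * pow u v (suc n) 1 + v * pow u v (suc n) 0   ≈⟨ +-cong (*-congˡ (pow-1 u v n)) (*-congˡ (pow-0 u v (suc n))) ⟩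
    u * (ι (suc n) * (v * u ^ n)) + v * (u * u ^ n)
      ≈⟨ solve 4 (λ u v m w → u :* (m :* (v :* w)) :+ v :* (u :* w)
           := (:1 :+ m) :* (v :* (u :* w))) refl u v (ι (suc n)) (u ^ n) ⟩
    (1# + ι (suc n)) * (v * (u * u ^ n))            ≈⟨ *-congʳ (ι-suc (suc n)) ⟨
    ι (2 ℕ.+ n) * (v * u ^ suc n)                   ∎

  -- The factor uⁱ avoids the truncated exponent n ∸ i of u.
  pow-coefficient : ∀ u v n i → u ^ i * pow u v n i ≈ ι (n C i) * (v ^ i * u ^ n)
  pow-coefficient u v n       zero    = trans (*-congˡ (pow-0 u v n)) (solve 1 (λ w → :1 :* w := :1 :* (:1 :* w)) refl (u ^ n))
  pow-coefficient u v zero    (suc i) = trans (zeroʳ _) (sym (zeroˡ _))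
  pow-coefficient u v (suc n) (suc i) = begin
    u * u ^ i * (u * s₁ + v * s₀)
      ≈⟨ solve 5 (λ u v w s₁ s₀ → u :* w :* (u :* s₁ :+ v :* s₀) := u :* (u :* w :* s₁) :+ u :* v :* (w :* s₀))
           refl u v (u ^ i) s₁ s₀ ⟩
    u * (u * u ^ i * s₁) + u * v * (u ^ i * s₀)
      ≈⟨ +-cong (*-congˡ (pow-coefficient u v n (suc i))) (*-congˡ (pow-coefficient u v n i)) ⟩
    u * (ι (n C suc i) * (v * v ^ i * u ^ n)) + u * v * (ι (n C i) * (v ^ i * u ^ n))
      ≈⟨ solve 6 (λ u v m₁ m₀ w z → u :* (m₁ :* (v :* w :* z)) :+ u :* v :* (m₀ :* (w :* z)) := (m₀ :+ m₁) :* (v :* w :* (u :* z)))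
           refl u v (ι (n C suc i)) (ι (n C i)) (v ^ i) (u ^ n) ⟩
    (ι (n C i) + ι (n C suc i)) * (v * v ^ i * (u * u ^ n))
      ≈⟨ *-congʳ (×-homo-+ 1# (n C i) (n C suc i)) ⟨
    ι (n C i ℕ.+ n C suc i) * (v * v ^ i * (u * u ^ n))
      ≡⟨ ≡.cong (λ m → ι m * (v * v ^ i * (u * u ^ n))) (nCk+nC[k+1]≡[n+1]C[k+1] n i) ⟩
    ι (suc n C suc i) * (v * v ^ i * (u * u ^ n))   ∎
    where
    s₀ = pow u v n i
    s₁ = pow u v n (suc i)

  Poly-pow : ∀ n → Poly (suc n) (λ x → pow x 1# n)
  Poly-pow zero    = Poly-const 1#
  Poly-pow (suc n) = Poly-X* (Poly-pow n)

  Poly-c-X* : ∀ {d φ} c → Poly d φ → Poly (suc d) (λ x → lin (c - x) (- 1#) (φ x))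
  Poly-c-X* c P = Poly-resp (λ x → lin-cong (solve 2 (λ c x → c :+ (:- :1) :* x := c :- x) refl c x) refl (λ _ → refl))
    (Poly-lin c (- 1#) P)

  Poly-c-pow : ∀ c n → Poly (suc n) (λ x → pow (c - x) (- 1#) n)
  Poly-c-pow c zero    = Poly-const 1#
  Poly-c-pow c (suc n) = Poly-c-X* c (Poly-c-pow c n)

  -- The leading terms cancel. With D = (c - X)ⁿ - (-1)ⁿ Xⁿ, the next difference is (c - X) D + c
  -- (-1)ⁿ Xⁿ.
  Poly-pow-difference : ∀ c n → Poly n (λ x i → pow (c - x) (- 1#) n i - (- 1#) ^ n * pow x 1# n i)
  Poly-pow-difference c zero = Poly-resp (λ x i → solve 1 (λ s → :0 := s :- :1 :* s) refl (const 1# i)) (Poly-zero 0)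
  Poly-pow-difference c (suc n) = Poly-resp eq
    (Poly-+ (Poly-c-X* c (Poly-pow-difference c n)) (Poly-scale (c * (- 1#) ^ n) (Poly-pow n)))
    where
    eq : ∀ x i → lin (c - x) (- 1#) (λ j → pow (c - x) (- 1#) n j - (- 1#) ^ n * pow x 1# n j) i + (c * (- 1#) ^ n) * pow x 1# n i
              ≈ pow (c - x) (- 1#) (suc n) i - (- 1#) ^ suc n * pow x 1# (suc n) i
    eq x zero    = solve 5 (λ c x e s t → (c :- x) :* (s :- e :* t) :+ (c :* e) :* t := (c :- x) :* s :- ((:- :1) :* e) :* (x :* t))
                     refl c x ((- 1#) ^ n) (pow (c - x) (- 1#) n 0) (pow x 1# n 0)
    eq x (suc i) = solve 7 (λ c x e s t s′ t′ →
        (c :- x) :* (s :- e :* t) :+ (:- :1) :* (s′ :- e :* t′) :+ (c :* e) :* t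
      := (c :- x) :* s :+ (:- :1) :* s′ :- ((:- :1) :* e) :* (x :* t :+ :1 :* t′))
      refl c x ((- 1#) ^ n) (pow (c - x) (- 1#) n (suc i)) (pow x 1# n (suc i)) (pow (c - x) (- 1#) n i) (pow x 1# n i)

  -- The Taylor expansion at x of Xⁿ + (c - X)ⁿ - b.
  powerSum : Carrier → Carrier → ℕ → Carrier → Seq
  powerSum c b n x i = pow x 1# n i + pow (c - x) (- 1#) n i + const (- b) i

  Poly-powerSum : ∀ c b n → Poly (suc n) (powerSum c b n)
  Poly-powerSum c b n = Poly-+ (Poly-+ (Poly-pow n) (Poly-c-pow c n)) (Poly-≤ (s≤s z≤n) (Poly-const (- b)))

  -- For an odd exponent the sum of the two powers is the difference bounded in
  -- `Poly-pow-difference`, so the degree drops by one.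
  Poly-powerSum-odd : ∀ c b j → Poly (suc (j ℕ.* 2)) (powerSum c b (suc (j ℕ.* 2)))
  Poly-powerSum-odd c b j = Poly-+
    (Poly-resp (λ x i → begin
        pow (c - x) (- 1#) n i - (- 1#) ^ n * pow x 1# n i ≈⟨ +-congˡ (-‿cong (*-congʳ (-1^odd≈-1 j))) ⟩
        pow (c - x) (- 1#) n i - (- 1#) * pow x 1# n i
          ≈⟨ solve 2 (λ s t → s :- (:- :1) :* t := t :+ s) refl (pow (c - x) (- 1#) n i) (pow x 1# n i) ⟩
        pow x 1# n i + pow (c - x) (- 1#) n i              ∎)
      (Poly-pow-difference c n))
    (Poly-≤ (s≤s z≤n) (Poly-const (- b)))
    where
    n = suc (j ℕ.* 2)

  powerSum-0 : ∀ c b n x → powerSum c b n x 0 ≈ x ^ n + (c - x) ^ n - b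
  powerSum-0 c b n x = +-congʳ (+-cong (pow-0 _ _ n) (pow-0 _ _ n))

  -- For the exponent m = 2 + n the coefficient of ε at 0 is -m c^(m-1); m ≥ 2 makes the
  -- contribution of X^m vanish there.
  powerSum≈0⇒ι≈0 : ∀ {c b} n → ¬ c ≈ 0# → (∀ x i → powerSum c b (2 ℕ.+ n) x i ≈ 0#) → ι (2 ℕ.+ n) ≈ 0#
  powerSum≈0⇒ι≈0 {c} {b} n c≉0 e = xy≈0⇒y≈0 (^-≉0 (suc n) c≉0) (begin
    c ^ suc n * ι m
      ≈⟨ solve 3 (λ w m z → w :* m
           := :- (m :* (:1 :* (:0 :* z)) :+ m :* ((:- :1) :* w) :+ :0)) refl (c ^ suc n) (ι m) (0# ^ n) ⟩
    - (ι m * (1# * (0# * 0# ^ n)) + ι m * (- 1# * c ^ suc n) + 0#)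
      ≈⟨ -‿cong (+-congʳ (+-cong (pow-1 0# 1# (suc n)) (trans (pow-1 (c - 0#) (- 1#) (suc n)) (*-congˡ (*-congˡ (^-congˡ (suc n) c-0≈c)))))) ⟨
    - powerSum c b m 0# 1
      ≈⟨ -‿cong (e 0# 1) ⟩
    - 0#   ≈⟨ -0#≈0# ⟩
    0#     ∎)
    where
    m = 2 ℕ.+ n
    c-0≈c : c - 0# ≈ c
    c-0≈c = solve 1 (λ c → c :- :0 := c) refl c

  -- Fermat's theorem and the characteristic.

  product : ∀ {n} → (Fin n → Carrier) → Carrier
  product = Product.sum

  translation-permutation : (g h : Carrier → Carrier) →
    (∀ {x y} → x ≈ y → g x ≈ g y) → (∀ {x y} → x ≈ y → h x ≈ h y) →
    (∀ x → g (h x) ≈ x) → (∀ x → h (g x) ≈ x) → Permutation′ q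
  translation-permutation g h g-cong h-cong gh hg = permutation
    (λ i → index (g (element i))) (λ i → index (h (element i)))
    (λ i → ≡.trans (index-cong (trans (g-cong (element-index _)) (gh _))) (index-element i))
    (λ i → ≡.trans (index-cong (trans (h-cong (element-index _)) (hg _))) (index-element i))

  product-all-but-one : ∀ {n} (w : Fin n → Carrier) i y → w i ≈ 1# → (∀ j → ¬ j ≡ i → w j ≈ y) →
                        product w ≈ y ^ pred n
  product-all-but-one {suc n} w i y wi wj = begin
    product w                    ≈⟨ Product.sum-remove {i = i} w ⟩
    w i * product (removeAt w i) ≈⟨ *-cong wi (Product.sum-cong-≋ (λ j → wj (punchIn i j) (Fin.punchInᵢ≢i i j))) ⟩
    1# * product (replicate n y) ≈⟨ *-identityˡ _ ⟩
    product (replicate n y)      ≈⟨ Product.sum-replicate n ⟩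
    y ^ n                        ∎

  product-≉0 : ∀ {n} (w : Fin n → Carrier) → (∀ i → ¬ w i ≈ 0#) → ¬ product w ≈ 0#
  product-≉0 {zero}  w w≉0 = 1≉0
  product-≉0 {suc n} w w≉0 = *-≉0 (w≉0 zero) (product-≉0 (w ∘ suc) (w≉0 ∘ suc))

  -- The factor by which `nonzeroPart` changes when its argument z is multiplied by y ≠ 0. Replacing
  -- 0 by 1 lets a product over the whole field stand for the product of the nonzero elements.
  fromNonzero : Carrier → Carrier → Carrier
  fromNonzero y z with z ≟ 0#
  ... | yes _ = 1#
  ... | no  _ = y

  fromNonzero-zero : ∀ y {z} → z ≈ 0# → fromNonzero y z ≈ 1#
  fromNonzero-zero y {z} z≈0 with z ≟ 0#
  ... | yes _   = refl
  ... | no  z≉0 = contradiction z≈0 z≉0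

  fromNonzero-nonzero : ∀ y {z} → ¬ z ≈ 0# → fromNonzero y z ≈ y
  fromNonzero-nonzero y {z} z≉0 with z ≟ 0#
  ... | yes z≈0 = contradiction z≈0 z≉0
  ... | no  _   = refl

  nonzeroPart : Carrier → Carrier
  nonzeroPart z = fromNonzero z z

  nonzeroPart-≉0 : ∀ z → ¬ nonzeroPart z ≈ 0#
  nonzeroPart-≉0 z with z ≟ 0#
  ... | yes _   = 1≉0
  ... | no  z≉0 = z≉0

  nonzeroPart-cong : ∀ {z z′} → z ≈ z′ → nonzeroPart z ≈ nonzeroPart z′
  nonzeroPart-cong {z} {z′} e with z ≟ 0#
  ... | yes z≈0 = sym (fromNonzero-zero z′ (trans (sym e) z≈0))
  ... | no  z≉0 = trans e (sym (fromNonzero-nonzero z′ (z≉0 ∘ trans e)))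

  nonzeroPart-* : ∀ {y} → ¬ y ≈ 0# → ∀ z → nonzeroPart (y * z) ≈ fromNonzero y z * nonzeroPart z
  nonzeroPart-* {y} y≉0 z with z ≟ 0#
  ... | yes z≈0 = trans (fromNonzero-zero (y * z) (trans (*-congˡ z≈0) (zeroʳ y))) (sym (*-identityˡ 1#))
  ... | no  z≉0 = fromNonzero-nonzero (y * z) (*-≉0 y≉0 z≉0)

  -- z ↦ y z permutes the field, so y ^ (q - 1) times the product of the nonzero elements is
  -- that product.
  fermat : ∀ {y} → ¬ y ≈ 0# → y ^ pred q ≈ 1#
  fermat {y} y≉0 = *-cancelˡ-≉0 (product-≉0 f (nonzeroPart-≉0 ∘ element)) (begin
    product f * y ^ pred q   ≈⟨ *-congˡ (product-all-but-one w (index 0#) y (fromNonzero-zero y (element-index 0#)) w≈y) ⟨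
    product f * product w    ≈⟨ *-comm _ _ ⟩
    product w * product f    ≈⟨ Product.∑-distrib-+ w f ⟨
    product (λ i → w i * f i)
      ≈⟨ Product.sum-cong-≋ {x = f ∘ Inverse.to π} {λ i → w i * f i} (λ i → trans (nonzeroPart-cong (element-index (y * element i))) (nonzeroPart-* y≉0 (element i))) ⟨
    product (λ i → f (Inverse.to π i)) ≈⟨ Product.sum-permute f π ⟨
    product f                ≈⟨ *-identityʳ _ ⟨
    product f * 1#           ∎)
    where
    f w : Fin q → Carrier
    f i = nonzeroPart (element i)
    w i = fromNonzero y (element i)
    w≈y : ∀ j → ¬ j ≡ index 0# → w j ≈ y
    w≈y j j≢ = fromNonzero-nonzero y λ e → j≢ (≡.trans (≡.sym (index-element j)) (index-cong e))
    y⁻¹ = proj₁ (inverse y y≉0)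
    yy⁻¹ = proj₂ (inverse y y≉0)
    π = translation-permutation (y *_) (y⁻¹ *_) *-congˡ *-congˡ
      (λ x → trans (sym (*-assoc _ _ _)) (trans (*-congʳ yy⁻¹) (*-identityˡ x)))
      (λ x → trans (sym (*-assoc _ _ _)) (trans (*-congʳ (trans (*-comm _ _) yy⁻¹)) (*-identityˡ x)))

  -- Translation by 1 permutes the field, so the sum of all x equals the sum of all x + 1.
  ιq≈0 : ι q ≈ 0#
  ιq≈0 = begin
    ι q                       ≈⟨ ×ᵤ≈× q 1# ⟨
    q ·ᵤ 1#                   ≈⟨ Sum.sum-replicate q ⟨
    Σ1                        ≈⟨ solve 2 (λ s t → t := (s :+ t) :- s) refl Σf Σ1 ⟩
    (Σf + Σ1) - Σf            ≈⟨ +-congʳ (Sum.∑-distrib-+ element (λ _ → 1#)) ⟨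
    Sum.sum (λ i → element i + 1#) - Σf
      ≈⟨ +-congʳ (Sum.sum-cong-≋ {x = λ i → element (Inverse.to π i)} {λ i → element i + 1#} (λ i → element-index (element i + 1#))) ⟨
    Sum.sum (λ i → element (Inverse.to π i)) - Σf ≈⟨ +-congʳ (Sum.sum-permute element π) ⟨
    Σf - Σf                   ≈⟨ -‿inverseʳ Σf ⟩
    0#                        ∎
    where
    Σf = Sum.sum element
    Σ1 = Sum.sum {q} (λ _ → 1#)
    π = translation-permutation (_+ 1#) (_- 1#) +-congʳ +-congʳ
      (λ x → solve 1 (λ x → x :- :1 :+ :1 := x) refl x)
      (λ x → solve 1 (λ x → x :+ :1 :- :1 := x) refl x)

  ι-* : ∀ m n → ι (m ℕ.* n) ≈ ι m * ι n
  ι-* = ×1-homo-*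

  ι-^ : ∀ m n → ι (m ℕ.^ n) ≈ ι m ^ n
  ι-^ m zero    = refl
  ι-^ m (suc n) = trans (ι-* m (m ℕ.^ n)) (*-congˡ (ι-^ m n))

  Characteristic : ℕ → Set _
  Characteristic p = ι p ≈ 0#

  characteristic : ∀ p f → q ≡ p ℕ.^ f → Characteristic p
  characteristic p f q≡p^f with ι p ≟ 0#
  ... | yes e  = e
  ... | no ιp≉0 = contradiction
    (trans (sym (ι-^ p f)) (trans (reflexive (≡.cong ι (≡.sym q≡p^f))) ιq≈0)) (^-≉0 f ιp≉0)

  module PrimeCharacteristic {p} (p-prime : Prime p) (ιp≈0 : Characteristic p) where

    ∣⇒ι≈0 : ∀ {m} → p ∣ m → ι m ≈ 0#
    ∣⇒ι≈0 (divides n ≡.refl) = trans (ι-* n p) (trans (*-congˡ ιp≈0) (zeroʳ _))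

    -- If p ∤ m, Bézout gives a multiple of p and a multiple of m that differ by 1; both are 0 in
    -- the field, which would make 1 = 0.
    ι≈0⇒∣ : ∀ {m} → ι m ≈ 0# → p ∣ m
    ι≈0⇒∣ {m} ιm≈0 with p ∣? m
    ... | yes p∣m = p∣m
    ... | no  p∤m = contradiction (1≈0 (coprime-Bézout (prime∤⇒coprime p-prime p∤m))) 1≉0
      where
      multiple≈0 : ∀ x {n} → ι n ≈ 0# → ι (x ℕ.* n) ≈ 0#
      multiple≈0 x {n} e = trans (ι-* x n) (trans (*-congˡ e) (zeroʳ _))
      1≈ι : ∀ {z w} → ι z ≈ 0# → ι w ≈ 0# → suc z ≡ w → 1# ≈ 0#
      1≈ι {z} {w} z≈0 w≈0 e = begin
        1#          ≈⟨ +-identityʳ 1# ⟨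
        1# + 0#     ≈⟨ +-congˡ z≈0 ⟨
        1# + ι z    ≈⟨ ι-suc z ⟨
        ι (suc z)   ≡⟨ ≡.cong ι e ⟩
        ι w         ≈⟨ w≈0 ⟩
        0#          ∎
      1≈0 : Bézout.Identity 1 p m → 1# ≈ 0#
      1≈0 (Bézout.+- x y eq) = 1≈ι (multiple≈0 y ιm≈0) (multiple≈0 x ιp≈0) eq
      1≈0 (Bézout.-+ x y eq) = 1≈ι (multiple≈0 x ιp≈0) (multiple≈0 y ιm≈0) eq

    ∤⇒ι≉0 : ∀ {m} → ¬ p ∣ m → ¬ ι m ≈ 0#
    ∤⇒ι≉0 p∤m = p∤m ∘ ι≈0⇒∣

  -- The Frobenius map and its fixed fields.

  -- By `prime∣C` all terms of the binomial expansion but the two outer ones are zero.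
  frobenius-prime : ∀ {n} → Prime (suc n) → Characteristic (suc n) → ∀ x y →
                    (x + y) ^ suc n ≈ x ^ suc n + y ^ suc n
  frobenius-prime {n} pr ιp≈0 x y = begin
    (x + y) ^ suc n                             ≈⟨ Binomial.theorem (suc n) x y ⟩
    term zero + Sum.sum (term ∘ suc)            ≈⟨ +-congˡ (Sum.sum-init-last (term ∘ suc)) ⟩
    term zero + (Sum.sum (λ k → term (suc (inject₁ k))) + term (fromℕ (suc n)))
      ≈⟨ +-cong first (+-cong (trans (Sum.sum-cong-≋ middle) (Sum.sum-replicate-zero n)) last) ⟩
    y ^ suc n + (0# + x ^ suc n)                ≈⟨ solve 2 (λ x y → y :+ (:0 :+ x) := x :+ y) refl _ _ ⟩
    x ^ suc n + y ^ suc n                       ∎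
    where
    open PrimeCharacteristic pr ιp≈0
    term : Fin (2 ℕ.+ n) → Carrier
    term = Binomial.binomialTerm x y (suc n)
    first : term zero ≈ y ^ suc n
    first = solve 1 (λ z → :1 :* z :+ :0 := z) refl (y ^ suc n)
    last : term (fromℕ (suc n)) ≈ x ^ suc n
    last rewrite Fin.toℕ-fromℕ n | nCn≡1 (suc n) | ℕ.n∸n≡0 n = solve 1 (λ z → z :* :1 :+ :0 := z) refl (x ^ suc n)
    middle : ∀ k → term (suc (inject₁ k)) ≈ 0#
    middle k = begin
      m ·ᵤ z          ≈⟨ ×-congʳ m (*-identityˡ z) ⟨
      m ·ᵤ (1# * z)   ≈⟨ ×-assoc-* m 1# z ⟨
      m ·ᵤ 1# * z     ≈⟨ *-congʳ (×ᵤ≈× m 1#) ⟩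
      ι m * z         ≈⟨ *-congʳ (∣⇒ι≈0 (prime∣C pr (≡.subst (_< n) (≡.sym (Fin.toℕ-inject₁ k)) (Fin.toℕ<n k)))) ⟩
      0# * z          ≈⟨ zeroˡ z ⟩
      0#              ∎
      where
      m = suc n C suc (toℕ (inject₁ k))
      z = Binomial.binomial x y (suc n) (suc (inject₁ k))

  Additive : ℕ → Set _
  Additive M = ∀ x y → (x + y) ^ M ≈ x ^ M + y ^ M

  frobenius : ∀ {p} → Prime p → Characteristic p → ∀ s → Additive (p ℕ.^ s)
  frobenius pr ιp≈0 zero x y = solve 2 (λ x y → (x :+ y) :* :1 := x :* :1 :+ y :* :1) refl x y
  frobenius {zero} pr ιp≈0 (suc s) x y = contradiction pr ¬prime[0]
  frobenius {p@(suc _)} pr ιp≈0 (suc s) x y = begin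
    (x + y) ^ (p ℕ.* p ℕ.^ s)               ≈⟨ ^-assocʳ (x + y) p (p ℕ.^ s) ⟨
    ((x + y) ^ p) ^ (p ℕ.^ s)               ≈⟨ ^-congˡ (p ℕ.^ s) (frobenius-prime pr ιp≈0 x y) ⟩
    (x ^ p + y ^ p) ^ (p ℕ.^ s)             ≈⟨ frobenius pr ιp≈0 s (x ^ p) (y ^ p) ⟩
    (x ^ p) ^ (p ℕ.^ s) + (y ^ p) ^ (p ℕ.^ s) ≈⟨ +-cong (^-assocʳ x p (p ℕ.^ s)) (^-assocʳ y p (p ℕ.^ s)) ⟩
    x ^ (p ℕ.* p ℕ.^ s) + y ^ (p ℕ.* p ℕ.^ s) ∎

  -- An additive power map is a ring endomorphism. The exponent is a successor so that 0 is fixed.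
  fixed-isSubfield : ∀ M → Additive (suc M) → IsSubfield (λ x → x ^ suc M ≈ x)
  fixed-isSubfield M additive = record
    { resp-≈     = λ e fx → trans (^-congˡ (suc M) (sym e)) (trans fx e)
    ; 0#-closed  = 0^M≈0
    ; 1#-closed  = 1^n≈1 (suc M)
    ; +-closed   = λ fx fy → trans (additive _ _) (+-cong fx fy)
    -- Additivity at x + (- x) = 0 determines the power of - x, whatever the parity of the exponent.
    ; neg-closed = λ {x} fx → begin
        (- x) ^ suc M                     ≈⟨ solve 2 (λ u v → v := (u :+ v) :- u) refl (x ^ suc M) _ ⟩
        (x ^ suc M + (- x) ^ suc M) - x ^ suc M ≈⟨ +-congʳ (additive x (- x)) ⟨
        (x - x) ^ suc M - x ^ suc M       ≈⟨ +-cong (trans (^-congˡ (suc M) (-‿inverseʳ x)) 0^M≈0) (-‿cong fx) ⟩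
        0# - x                            ≈⟨ +-identityˡ _ ⟩
        - x                               ∎
    ; *-closed   = λ fx fy → trans (^-distrib-* _ _ (suc M)) (*-cong fx fy)
    ; inv-closed = λ {x} {y} fx xy≈1 → *-cancelˡ-≉0
        (λ x≈0 → 1≉0 (trans (sym xy≈1) (trans (*-congʳ x≈0) (zeroˡ y)))) (begin
        x * y ^ suc M           ≈⟨ *-congʳ fx ⟨
        x ^ suc M * y ^ suc M   ≈⟨ ^-distrib-* x y (suc M) ⟨
        (x * y) ^ suc M         ≈⟨ ^-congˡ (suc M) xy≈1 ⟩
        1# ^ suc M              ≈⟨ 1^n≈1 (suc M) ⟩
        1#                      ≈⟨ xy≈1 ⟨
        x * y                   ∎)
    }
    where
    0^M≈0 : 0# ^ suc M ≈ 0#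
    0^M≈0 = zeroˡ _

  -- Counting roots and fibres; the order of the group of k-th powers.

  elements-distinct : Distinct elements
  elements-distinct = AllPairs.map⁺ (AllPairs.map
    (λ {i} {j} i≢j e → i≢j (≡.trans (≡.sym (index-element i)) (≡.trans (index-cong e) (index-element j))))
    (Unique.allFin⁺ q))

  length-elements : length elements ≡ q
  length-elements = ≡.trans (List.length-map element (List.allFin q)) (List.length-tabulate {n = q} id)

  -- Otherwise X^(2+M) - X has more roots than its degree and vanishes, although its coefficient of
  -- ε at 0 is -1.
  fixed-by-power⇒q≤ : ∀ M → (∀ x → x ^ (2 ℕ.+ M) ≈ x) → q ≤ 2 ℕ.+ M
  fixed-by-power⇒q≤ M fix with q ℕ.≤? 2 ℕ.+ M
  ... | yes q≤ = q≤
  ... | no  q≰ = contradiction (begin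
      1#
        ≈⟨ solve 2 (λ m w → :1 := :- (m :* (:1 :* (:0 :* w)) :+ (:- :1) :* (:1 :* (:1 :* :1)))) refl (ι (2 ℕ.+ M)) (0# ^ M) ⟩
      - (ι (2 ℕ.+ M) * (1# * 0# ^ suc M) + - 1# * (ι 1 * (1# * 0# ^ 0)))
                  ≈⟨ -‿cong (+-cong (pow-1 0# 1# (suc M)) (*-congˡ (pow-1 0# 1# 0))) ⟨
      - φ 0# 1    ≈⟨ -‿cong (many-roots⇒zero elements elements-distinct
                      (≡.subst (3 ℕ.+ M ≤_) (≡.sym length-elements) (ℕ.≰⇒> q≰)) Pφ (All.universal root elements) 0# 1) ⟩
      - 0#        ≈⟨ -0#≈0# ⟩
      0#          ∎) 1≉0
    where
    φ : Carrier → Seq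
    φ x i = pow x 1# (2 ℕ.+ M) i + - 1# * pow x 1# 1 i
    Pφ : Poly (3 ℕ.+ M) φ
    Pφ = Poly-+ (Poly-pow (2 ℕ.+ M)) (Poly-scale (- 1#) (Poly-≤ (s≤s (s≤s z≤n)) (Poly-pow 1)))
    root : ∀ x → Root φ x
    root x = begin
      pow x 1# (2 ℕ.+ M) 0 + - 1# * pow x 1# 1 0  ≈⟨ +-cong (trans (pow-0 x 1# (2 ℕ.+ M)) (fix x)) (*-congˡ (pow-0 x 1# 1)) ⟩
      x + - 1# * (x * 1#)                         ≈⟨ solve 1 (λ x → x :+ (:- :1) :* (x :* :1) := :0) refl x ⟩
      0#                                          ∎

  -- X^(m+1) - b is not the zero polynomial, as its value at 0 is - b.
  power-fiber-≤ : ∀ m {b} zs → ¬ b ≈ 0# → Distinct zs → All (λ z → z ^ suc m ≈ b) zs → length zs ≤ suc m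
  power-fiber-≤ m {b} zs b≉0 zs! zs^m with length zs ℕ.≤? suc m
  ... | yes ≤m = ≤m
  ... | no  ≰m = contradiction (begin
      b           ≈⟨ solve 2 (λ b w → b := :- (:0 :* w :- b)) refl b (0# ^ m) ⟩
      - (0# ^ suc m - b)  ≈⟨ -‿cong (+-congʳ (pow-0 0# 1# (suc m))) ⟨
      - φ 0# 0    ≈⟨ -‿cong (many-roots⇒zero zs zs! (ℕ.≰⇒> ≰m) Pφ (All.map root zs^m) 0# 0) ⟩
      - 0#        ≈⟨ -0#≈0# ⟩
      0#          ∎) b≉0
    where
    φ : Carrier → Seq
    φ x i = pow x 1# (suc m) i + const (- b) i
    Pφ : Poly (2 ℕ.+ m) φ
    Pφ = Poly-+ (Poly-pow (suc m)) (Poly-≤ (s≤s z≤n) (Poly-const (- b)))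
    root : ∀ {z} → z ^ suc m ≈ b → Root φ z
    root {z} e = trans (+-congʳ (trans (pow-0 z 1# (suc m)) e)) (-‿inverseʳ b)

  length-filter-split : ∀ {ℓ} {P : Pred Carrier ℓ} (P? : Decidable P) xs →
    length xs ≡ length (List.filter P? xs) ℕ.+ length (List.filter (¬? ∘ P?) xs)
  length-filter-split P? [] = ≡.refl
  length-filter-split P? (x ∷ xs) with P? x
  ... | yes _ = ≡.cong suc (length-filter-split P? xs)
  ... | no  _ = ≡.trans (≡.cong suc (length-filter-split P? xs)) (≡.sym (ℕ.+-suc _ _))

  -- Split off from xs the fibre over the first entry of ys and recurse on the rest.
  length≤fibers : ∀ (g : Carrier → Carrier) k ys xs → Distinct xs →
    All (λ y → ∀ zs → Distinct zs → All (λ z → g z ≈ y) zs → length zs ≤ k) ys →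
    All (λ x → Any (λ y → g x ≈ y) ys) xs → length xs ≤ length ys ℕ.* k
  length≤fibers g k []       []       _   _        _        = z≤n
  length≤fibers g k []       (x ∷ xs) _   _        (() ∷ _)
  length≤fibers g k (y ∷ ys) xs       xs! (b ∷ bs) cover    = ℕ.≤-trans
    (ℕ.≤-reflexive (length-filter-split y? xs))
    (ℕ.+-mono-≤ (b (List.filter y? xs) (AllPairs.filter⁺ y? xs!) (All.all-filter y? xs))
      (length≤fibers g k ys (List.filter (¬? ∘ y?) xs) (AllPairs.filter⁺ (¬? ∘ y?) xs!) bs
        (All.zipWith (λ { (gx≉y , here gx≈y) → contradiction gx≈y gx≉y ; (_ , there gx∈ys) → gx∈ys })
          (All.all-filter (¬? ∘ y?) xs , All.filter⁺ (¬? ∘ y?) cover))))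
    where
    y? : Decidable (λ x → g x ≈ y)
    y? x = g x ≟ y

  all-equal⇒length≤1 : ∀ {y} zs → Distinct zs → All (_≈ y) zs → length zs ≤ 1
  all-equal⇒length≤1 []           _               _               = z≤n
  all-equal⇒length≤1 (_ ∷ [])     _               _               = s≤s z≤n
  all-equal⇒length≤1 (_ ∷ _ ∷ _) ((z≉w ∷ _) ∷ _) (z≈y ∷ w≈y ∷ _) = contradiction (trans z≈y (sym w≈y)) z≉w

  nonzeroElements : List Carrier
  nonzeroElements = List.filter (¬? ∘ (_≟ 0#)) elements

  q≤1+∣nonzeroElements∣ : q ≤ suc (length nonzeroElements)
  q≤1+∣nonzeroElements∣ = ℕ.≤-trans (ℕ.≤-reflexive (≡.trans (≡.sym length-elements) (length-filter-split (_≟ 0#) elements)))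
    (ℕ.+-monoˡ-≤ _ (all-equal⇒length≤1 (List.filter (_≟ 0#) elements)
      (AllPairs.filter⁺ (_≟ 0#) elements-distinct) (All.all-filter (_≟ 0#) elements)))

  ∈-elements : ∀ {p} {P : Pred Carrier p} → (∀ {x y} → x ≈ y → P x → P y) → ∀ {x} → P x → Any P elements
  ∈-elements P-resp {x} Px = Any.map⁺ (Any.tabulate⁺ (index x) (P-resp (sym (element-index x)) Px))

  powerList : ℕ → List Carrier
  powerList k = List.filter (powers? k) elements

  powerList-distinct : ∀ k → Distinct (powerList k)
  powerList-distinct k = AllPairs.filter⁺ (powers? k) elements-distinct

  Powers-nonzero : ∀ {k x} → Powers k x → ¬ x ≈ 0#
  Powers-nonzero {k} (y , y≉0 , y^k≈x) x≈0 = ^-≉0 k y≉0 (trans y^k≈x x≈0)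

  Powers⇒^t≈1 : ∀ {t k} → t ℕ.* k ≡ pred q → ∀ {x} → Powers k x → x ^ t ≈ 1#
  Powers⇒^t≈1 {t} {k} tk≡q-1 {x} (y , y≉0 , y^k≈x) = begin
    x ^ t              ≈⟨ ^-congˡ t y^k≈x ⟨
    (y ^ k) ^ t        ≈⟨ ^-assocʳ y k t ⟩
    y ^ (k ℕ.* t)      ≡⟨ ≡.cong (y ^_) (≡.trans (ℕ.*-comm k t) tk≡q-1) ⟩
    y ^ pred q         ≈⟨ fermat y≉0 ⟩
    1#                 ∎

  -- By Fermat's theorem every k-th power is a root of unity of order dividing (q - 1) / k.
  ∣Powers∣≤t : ∀ t k → suc t ℕ.* k ≡ pred q → length (powerList k) ≤ suc t
  ∣Powers∣≤t t k tk≡q-1 = power-fiber-≤ t (powerList k) 1≉0 (powerList-distinct k)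
    (All.map (Powers⇒^t≈1 {suc t} {k} tk≡q-1) (All.all-filter (powers? k) elements))

  Any-filter : ∀ {ℓ ℓ′} {P : Pred Carrier ℓ} {Q : Pred Carrier ℓ′} (P? : Decidable P) {xs} →
               Any (λ y → P y × Q y) xs → Any Q (List.filter P? xs)
  Any-filter P? {x ∷ xs} any with P? x | any
  ... | yes _  | here (_ , Qx)  = here Qx
  ... | yes _  | there any′     = there (Any-filter P? any′)
  ... | no ¬Px | here (Px , _)  = contradiction Px ¬Px
  ... | no _   | there any′     = Any-filter P? any′

  -- The power map on the q - 1 nonzero elements has fibres no larger than its exponent, so its
  -- image is large.
  t≤∣Powers∣ : ∀ t k → t ℕ.* suc k ≡ pred q → t ≤ length (powerList (suc k))
  t≤∣Powers∣ t k tk≡q-1 = ℕ.*-cancelʳ-≤ t (length (powerList (suc k))) (suc k) (ℕ.≤-trans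
    (ℕ.≤-trans (ℕ.≤-reflexive tk≡q-1) (ℕ.pred-mono-≤ q≤1+∣nonzeroElements∣))
    (length≤fibers (_^ suc k) (suc k) (powerList (suc k)) nonzeroElements
      (AllPairs.filter⁺ (¬? ∘ (_≟ 0#)) elements-distinct)
      (All.map (λ {b} b∈A zs zs! zs^k → power-fiber-≤ k zs (Powers-nonzero {suc k} b∈A) zs! zs^k)
        (All.all-filter (powers? (suc k)) elements))
      (All.map (λ {x} x≉0 → Any-filter (powers? (suc k))
          (∈-elements {P = λ y → Powers (suc k) y × x ^ suc k ≈ y}
            (λ { y≈z ((w , w≉0 , w^k≈y) , x^k≈y) → (w , w≉0 , trans w^k≈y y≈z) , trans x^k≈y y≈z })
            ((x , x≉0 , refl) , refl)))
        (All.all-filter (¬? ∘ (_≟ 0#)) elements))))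

  -- Reduction of the exponent M m to m for additive M.

  AllPairs-map : ∀ {a r s p} {A : Set a} {R : A → A → Set r} {P : A → Set p} {S : Carrier → Carrier → Set s}
    (f : A → Carrier) → (∀ {x y} → P x → P y → R x y → S (f x) (f y)) →
    ∀ {xs} → All P xs → AllPairs R xs → AllPairs S (List.map f xs)
  AllPairs-map f step []         []           = []
  AllPairs-map f step (Px ∷ Pxs) (Rxs ∷ Rs) =
    All.map⁺ (All.zipWith (λ (Py , Rxy) → step Px Py Rxy) (Pxs , Rxs)) ∷ AllPairs-map f step Pxs Rs

  -- On u = x^M the equations x + y = c, x = x^(M m), y = y^(M m) become
  -- u^m + (c^M - u)^m = c, which has too many solutions u unless m = 1.
  additive-power⇒linear : ∀ {c} M m → Additive M → ¬ c ≈ 0# → ¬ ι m ≈ 0# → ∀ xs → Distinct xs →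
    All (λ x → x ^ (M ℕ.* m) ≈ x × (c - x) ^ (M ℕ.* m) ≈ c - x) xs →
    ((∃ λ j → m ≡ suc (j ℕ.* 2)) × m ≤ length xs) ⊎ suc m ≤ length xs → m ≡ 1
  additive-power⇒linear M 0 _ _ ιm≉0 _ _ _ _ = contradiction refl ιm≉0
  additive-power⇒linear M 1 _ _ _ _ _ _ _ = ≡.refl
  additive-power⇒linear {c} M m@(suc (suc m-2)) additive c≉0 ιm≉0 xs xs! fixed bound =
    contradiction (powerSum≈0⇒ι≈0 m-2 (^-≉0 M c≉0) (h≈0 bound)) ιm≉0
    where
    h : Carrier → Seq
    h = powerSum (c ^ M) c m
    us = List.map (_^ M) xs
    -- The m-th power of x^M is x again, so x ↦ x^M is injective on the solutions.
    us! : Distinct us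
    us! = AllPairs-map (_^ M) (λ (fx , _) (fy , _) x≉y e → x≉y (begin
      _                   ≈⟨ fx ⟨
      _                   ≈⟨ ^-assocʳ _ M m ⟨
      _                   ≈⟨ ^-congˡ m e ⟩
      _                   ≈⟨ ^-assocʳ _ M m ⟩
      _                   ≈⟨ fy ⟩
      _                   ∎)) fixed xs!
    root : ∀ {x} → x ^ (M ℕ.* m) ≈ x × (c - x) ^ (M ℕ.* m) ≈ c - x → Root h (x ^ M)
    root {x} (fx , fy) = begin
      h (x ^ M) 0                                       ≈⟨ powerSum-0 (c ^ M) c m (x ^ M) ⟩
      (x ^ M) ^ m + (c ^ M - x ^ M) ^ m - c             ≈⟨ +-congʳ (+-congˡ (^-congˡ m c^M-x^M)) ⟩
      (x ^ M) ^ m + ((c - x) ^ M) ^ m - c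
        ≈⟨ +-congʳ (+-cong (trans (^-assocʳ x M m) fx) (trans (^-assocʳ (c - x) M m) fy)) ⟩
      x + (c - x) - c                                   ≈⟨ solve 2 (λ x c → x :+ (c :- x) :- c := :0) refl x c ⟩
      0#                                                ∎
      where
      c^M-x^M : c ^ M - x ^ M ≈ (c - x) ^ M
      c^M-x^M = begin
        c ^ M - x ^ M                   ≈⟨ +-congʳ (^-congˡ M (solve 2 (λ x c → c := c :- x :+ x) refl x c)) ⟩
        (c - x + x) ^ M - x ^ M         ≈⟨ +-congʳ (additive (c - x) x) ⟩
        (c - x) ^ M + x ^ M - x ^ M     ≈⟨ solve 2 (λ u v → u :+ v :- v := u) refl _ (x ^ M) ⟩
        (c - x) ^ M                     ∎
    roots : All (Root h) us
    roots = All.map⁺ (All.map root fixed)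
    ∣us∣≡∣xs∣ = List.length-map (_^ M) xs
    h≈0 : ((∃ λ j → m ≡ suc (j ℕ.* 2)) × m ≤ length xs) ⊎ suc m ≤ length xs → ∀ x i → h x i ≈ 0#
    h≈0 (inj₁ ((j , m≡) , m≤)) = many-roots⇒zero us us! (≡.subst (m ≤_) (≡.sym ∣us∣≡∣xs∣) m≤)
      (≡.subst (λ m → Poly m (powerSum (c ^ M) c m)) (≡.sym m≡) (Poly-powerSum-odd (c ^ M) c j)) roots
    h≈0 (inj₂ m<) = many-roots⇒zero us us! (≡.subst (suc m ≤_) (≡.sym ∣us∣≡∣xs∣) m<)
      (Poly-powerSum (c ^ M) c m) roots

  -- Critical points of P and the expansions there.

  root-of-unity≉0 : ∀ {x t} → 0 < t → x ^ t ≈ 1# → ¬ x ≈ 0#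
  root-of-unity≉0 {x} {suc t} (s≤s z≤n) x^t≈1 x≈0 = 1≉0 (trans (sym x^t≈1) (trans (*-congʳ x≈0) (zeroˡ (x ^ t))))

  -- Made total by the value 0# at 0, so that `ratioPoint` depends on z alone.
  recip : Carrier → Carrier
  recip x with x ≟ 0#
  ... | yes _   = 0#
  ... | no  x≉0 = proj₁ (inverse x x≉0)

  recip-inverse : ∀ {x} → ¬ x ≈ 0# → x * recip x ≈ 1#
  recip-inverse {x} x≉0 with x ≟ 0#
  ... | yes x≈0  = contradiction x≈0 x≉0
  ... | no  x≉0′ = proj₂ (inverse x x≉0′)

  -- The coefficient is C(t+1,2) v² u^(t-1); the factor u replaces u^(t-1) by the known power u^t =
  -- s. Likewise u² in `u*u*pow-3`.
  u*pow-2 : ∀ {u s} v t → ¬ u ≈ 0# → u ^ t ≈ s → u * pow u v (suc t) 2 ≈ ι (suc t C 2) * (v * v * s)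
  u*pow-2 {u} {s} v t u≉0 u^t≈s = *-cancelˡ-≉0 u≉0 (begin
    u * (u * w)                         ≈⟨ solve 2 (λ u w → u :* (u :* w) := (u :* (u :* :1)) :* w) refl u w ⟩
    u ^ 2 * w                           ≈⟨ pow-coefficient u v (suc t) 2 ⟩
    C₂ * (v ^ 2 * (u * u ^ t))          ≈⟨ *-congˡ (*-congˡ (*-congˡ u^t≈s)) ⟩
    C₂ * (v ^ 2 * (u * s))
      ≈⟨ solve 4 (λ u v s m → m :* (v :* (v :* :1) :* (u :* s)) := u :* (m :* (v :* v :* s))) refl u v s C₂ ⟩
    u * (C₂ * (v * v * s))              ∎)
    where
    w = pow u v (suc t) 2
    C₂ = ι (suc t C 2)

  u*u*pow-3 : ∀ {u s} v t → ¬ u ≈ 0# → u ^ t ≈ s → u * u * pow u v (suc t) 3 ≈ ι (suc t C 3) * (v * v * v * s)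
  u*u*pow-3 {u} {s} v t u≉0 u^t≈s = *-cancelˡ-≉0 u≉0 (begin
    u * (u * u * w)                     ≈⟨ solve 2 (λ u w → u :* (u :* u :* w) := (u :* (u :* (u :* :1))) :* w) refl u w ⟩
    u ^ 3 * w                           ≈⟨ pow-coefficient u v (suc t) 3 ⟩
    C₃ * (v ^ 3 * (u * u ^ t))          ≈⟨ *-congˡ (*-congˡ (*-congˡ u^t≈s)) ⟩
    C₃ * (v ^ 3 * (u * s))
      ≈⟨ solve 4 (λ u v s m → m :* (v :* (v :* (v :* :1)) :* (u :* s)) := u :* (m :* (v :* v :* v :* s))) refl u v s C₃ ⟩
    u * (C₃ * (v * v * v * s))          ∎)
    where
    w = pow u v (suc t) 3
    C₃ = ι (suc t C 3)

  module _ (c : Carrier) (t : ℕ) (c≉0 : ¬ c ≈ 0#) where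

    private
      n = suc t
      C₂ = ι (n C 2)
      C₃ = ι (n C 3)
      P : Carrier → Seq
      P = powerSum c c n

    -- The zeros of P′ = n (X^t - (c - X)^t).
    record Critical (x : Carrier) : Set (a Level.⊔ ℓ₁) where
      field
        {value} : Carrier
        x≉0     : ¬ x ≈ 0#
        c-x≉0   : ¬ c - x ≈ 0#
        value≉0 : ¬ value ≈ 0#
        x^t     : x ^ t ≈ value
        [c-x]^t : (c - x) ^ t ≈ value

    module _ (C₂≉0 : ¬ C₂ ≈ 0#) {x} (crit : Critical x) where
      open Critical crit renaming (value to s)

      private
        y = c - x
        a₂ = pow x 1# n 2
        b₂ = pow y (- 1#) n 2
        a₃ = pow x 1# n 3
        b₃ = pow y (- 1#) n 3
        xy≉0 = *-≉0 x≉0 c-x≉0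

      critical-P₁ : P x 1 ≈ 0#
      critical-P₁ = begin
        pow x 1# n 1 + pow y (- 1#) n 1 + 0#   ≈⟨ +-congʳ (+-cong (trans (pow-1 x 1# t) (*-congˡ (*-congˡ x^t)))
                                                            (trans (pow-1 y (- 1#) t) (*-congˡ (*-congˡ [c-x]^t)))) ⟩
        ι n * (1# * s) + ι n * (- 1# * s) + 0#
          ≈⟨ solve 2 (λ m s → m :* (:1 :* s) :+ m :* ((:- :1) :* s) :+ :0 := :0) refl (ι n) s ⟩
        0#                                     ∎

      xy*P₂ : x * y * P x 2 ≈ C₂ * s * (x + y)
      xy*P₂ = begin
        x * y * (a₂ + b₂ + 0#)
          ≈⟨ solve 4 (λ x y a b → x :* y :* (a :+ b :+ :0) := y :* (x :* a) :+ x :* (y :* b)) refl x y a₂ b₂ ⟩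
        y * (x * a₂) + x * (y * b₂)
          ≈⟨ +-cong (*-congˡ (u*pow-2 1# t x≉0 x^t)) (*-congˡ (u*pow-2 (- 1#) t c-x≉0 [c-x]^t)) ⟩
        y * (C₂ * (1# * 1# * s)) + x * (C₂ * (- 1# * - 1# * s))
          ≈⟨ solve 4 (λ x y m s → y :* (m :* (:1 :* :1 :* s)) :+ x :* (m :* ((:- :1) :* (:- :1) :* s))
               := m :* s :* (x :+ y)) refl x y C₂ s ⟩
        C₂ * s * (x + y)                     ∎

      -- By `xy*P₂` and x + y = c, the coefficient is C(n,2) s c / (x y).
      critical-P₂≉0 : ¬ P x 2 ≈ 0#
      critical-P₂≉0 P₂≈0 = *-≉0 (*-≉0 C₂≉0 value≉0) c≉0 (begin
        C₂ * s * c          ≈⟨ *-congˡ (solve 2 (λ x c → c := x :+ (c :- x)) refl x c) ⟩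
        C₂ * s * (x + y)    ≈⟨ xy*P₂ ⟨
        x * y * P x 2       ≈⟨ trans (*-congˡ P₂≈0) (zeroʳ _) ⟩
        0#                  ∎)

      -- The two coefficients are C(n,2) s c / (x y) and C(n,3) s c (y - x) / (x y)². Eliminating
      -- the common value s gives one relation valid at zeros and nonzeros of P alike.
      critical-P₂-P₃ : C₂ * (x * y) * P x 3 ≈ C₃ * (y - x) * P x 2
      critical-P₂-P₃ = *-cancelˡ-≉0 xy≉0 (begin
        x * y * (C₂ * (x * y) * (a₃ + b₃ + 0#))
          ≈⟨ solve 5 (λ x y m a b → x :* y :* (m :* (x :* y) :* (a :+ b :+ :0))
               := m :* (y :* y :* (x :* x :* a) :+ x :* x :* (y :* y :* b))) refl x y C₂ a₃ b₃ ⟩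
        C₂ * (y * y * (x * x * a₃) + x * x * (y * y * b₃))
          ≈⟨ *-congˡ (+-cong (*-congˡ (u*u*pow-3 1# t x≉0 x^t)) (*-congˡ (u*u*pow-3 (- 1#) t c-x≉0 [c-x]^t))) ⟩
        C₂ * (y * y * (C₃ * (1# * 1# * 1# * s)) + x * x * (C₃ * (- 1# * - 1# * - 1# * s)))
          ≈⟨ solve 5 (λ x y m k s → m :* (y :* y :* (k :* (:1 :* :1 :* :1 :* s)) :+ x :* x :* (k :* ((:- :1) :* (:- :1) :* (:- :1) :* s)))
               := k :* (y :- x) :* (m :* s :* (x :+ y))) refl x y C₂ C₃ s ⟩
        C₃ * (y - x) * (C₂ * s * (x + y))    ≈⟨ *-congˡ xy*P₂ ⟨
        C₃ * (y - x) * (x * y * P x 2)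
          ≈⟨ solve 3 (λ w z k → k :* (w :* z) := w :* (k :* z)) refl (x * y) (P x 2) (C₃ * (y - x)) ⟩
        x * y * (C₃ * (y - x) * P x 2)       ∎)

    critical-P₀ : ∀ {x} (crit : Critical x) → P x 0 ≈ c * (Critical.value crit - 1#)
    critical-P₀ {x} crit = begin
      P x 0                                  ≈⟨ powerSum-0 c c n x ⟩
      x * x ^ t + (c - x) * (c - x) ^ t - c  ≈⟨ +-congʳ (+-cong (*-congˡ x^t) (*-congˡ [c-x]^t)) ⟩
      x * s + (c - x) * s - c
        ≈⟨ solve 3 (λ x c s → x :* s :+ (c :- x) :* s :- c := c :* (s :- :1)) refl x c s ⟩
      c * (s - 1#)                           ∎
      where open Critical crit renaming (value to s)

    -- z ↦ c / (1 + z) turns a t-th root of unity z into the critical point x with c - x = z x.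
    ratioPoint : Carrier → Carrier
    ratioPoint z = c * recip (1# + z)

    -- At z = -1 the denominator 1 + z vanishes; z = 1 gives the midpoint x = c - x, where the
    -- factor c - 2 x cancelled in `C₂+2C₃≈0` is zero.
    Ratio : Carrier → Set _
    Ratio z = z ^ t ≈ 1# × ¬ z ≈ 1# × ¬ z ≈ - 1#

    module _ {z} (ratio : Ratio z) where

      private
        x = ratioPoint z
        1+z≉0 : ¬ 1# + z ≈ 0#
        1+z≉0 e = proj₂ (proj₂ ratio) (trans (solve 1 (λ z → z := :1 :+ z :- :1) refl z) (trans (+-congʳ e) (+-identityˡ _)))

      [1+z]*ratioPoint : (1# + z) * x ≈ c
      [1+z]*ratioPoint = begin
        (1# + z) * (c * recip (1# + z))  ≈⟨ solve 3 (λ u c w → u :* (c :* w) := c :* (u :* w)) refl (1# + z) c _ ⟩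
        c * ((1# + z) * recip (1# + z))  ≈⟨ *-congˡ (recip-inverse 1+z≉0) ⟩
        c * 1#                           ≈⟨ *-identityʳ c ⟩
        c                                ∎

      ratioPoint≉0 : ¬ x ≈ 0#
      ratioPoint≉0 x≈0 = c≉0 (trans (sym [1+z]*ratioPoint) (trans (*-congˡ x≈0) (zeroʳ _)))

      c-ratioPoint : c - x ≈ z * x
      c-ratioPoint = trans (+-congʳ (sym [1+z]*ratioPoint)) (solve 2 (λ z x → (:1 :+ z) :* x :- x := z :* x) refl z x)

      ratioPoint-asymmetric : ¬ c - x - x ≈ 0#
      ratioPoint-asymmetric e = proj₁ (proj₂ ratio) (*-cancelˡ-≉0 ratioPoint≉0
        (trans (*-comm _ _) (trans (sym c-ratioPoint) (trans (x-y≈0⇒x≈y e) (sym (*-identityʳ x))))))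

      ratioPoint-critical : 0 < t → Critical x
      ratioPoint-critical 0<t = record
        { x≉0 = ratioPoint≉0
        ; c-x≉0 = λ e → *-≉0 (root-of-unity≉0 0<t (proj₁ ratio)) ratioPoint≉0 (trans (sym c-ratioPoint) e)
        ; value≉0 = ^-≉0 t ratioPoint≉0
        ; x^t = refl
        ; [c-x]^t = begin
            (c - x) ^ t     ≈⟨ ^-congˡ t c-ratioPoint ⟩
            (z * x) ^ t     ≈⟨ ^-distrib-* z x t ⟩
            z ^ t * x ^ t   ≈⟨ *-congʳ (proj₁ ratio) ⟩
            1# * x ^ t      ≈⟨ *-identityˡ _ ⟩
            x ^ t           ∎
        }

    ratioPoint-injective : ∀ {z z′} → Ratio z → Ratio z′ → ratioPoint z ≈ ratioPoint z′ → z ≈ z′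
    ratioPoint-injective {z} {z′} ratio ratio′ e = begin
      z              ≈⟨ solve 1 (λ z → z := :1 :+ z :- :1) refl z ⟩
      1# + z - 1#    ≈⟨ +-congʳ (*-cancelˡ-≉0 (ratioPoint≉0 ratio) (trans (*-comm _ _) (trans ([1+z]*ratioPoint ratio)
                          (trans (sym ([1+z]*ratioPoint ratio′)) (trans (*-comm _ _) (*-congʳ (sym e))))))) ⟩
      1# + z′ - 1#   ≈⟨ solve 1 (λ z → z := :1 :+ z :- :1) refl z′ ⟨
      z′             ∎

    Solution : Carrier → Set _
    Solution x = x ^ t ≈ 1# × (c - x) ^ t ≈ 1#

    solution-critical : 0 < t → ∀ {x} → Solution x → Critical x
    solution-critical 0<t (x^t≈1 , y^t≈1) = record
      { x≉0 = root-of-unity≉0 0<t x^t≈1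
      ; c-x≉0 = root-of-unity≉0 0<t y^t≈1
      ; value≉0 = 1≉0 ; x^t = x^t≈1 ; [c-x]^t = y^t≈1 }

    -- The factorisation P = α G² and its differential equation.

    module _ (0<t : 0 < t) (2≉0 : ¬ 1# + 1# ≈ 0#) (ιn≉0 : ¬ ι n ≈ 0#) (C₂≉0 : ¬ C₂ ≈ 0#)
             {xs} (xs! : Distinct xs) (solutions : All Solution xs)
             {zs} (zs! : Distinct zs) (ratios : All Ratio zs)
             -- The first bound leaves only a constant cofactor of G²; the second makes P zero if
             -- the critical points of all ratios are double roots.
             {d} (P-poly : Poly d P) (d≤2∣xs∣+1 : d ≤ suc (length xs ℕ.* 2)) (d≤2∣zs∣ : d ≤ length zs ℕ.* 2)
             where

      solution-root : ∀ {x} → Solution x → P x 0 ≈ 0#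
      solution-root sol = trans (critical-P₀ (solution-critical 0<t sol))
        (trans (*-congˡ (-‿inverseʳ 1#)) (zeroʳ c))

      private
        factorisation : ∃ λ α → ∀ x i → P x i ≈ α * ∏² xs x i
        factorisation = factor-doubleRoots xs xs! d≤2∣xs∣+1 P-poly
          (All.map (λ sol → solution-root sol , critical-P₁ C₂≉0 (solution-critical 0<t sol)) solutions)
        α = proj₁ factorisation
        G : Carrier → Seq
        G = ∏ xs

      P≈αG² : ∀ x i → i < 4 → P x i ≈ α * sq (G x) i
      P≈αG² x i i<4 = trans (proj₂ factorisation x i) (*-congˡ (∏²≈sq∏ xs x i i<4))

      -- Critical points are zeros of P′. If all those coming from zs were zeros of P as well, P
      -- would vanish identically, contrary to n ≠ 0 in the field.
      nonroot-ratio : ∃ λ z → Ratio z × ¬ P (ratioPoint z) 0 ≈ 0#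
      nonroot-ratio with All.all? (λ z → P (ratioPoint z) 0 ≟ 0#) zs
      ... | no ¬all = search ratios (All.¬All⇒Any¬ (λ z → P (ratioPoint z) 0 ≟ 0#) zs ¬all)
        where
        search : ∀ {zs} → All Ratio zs → Any (λ z → ¬ P (ratioPoint z) 0 ≈ 0#) zs → ∃ λ z → Ratio z × ¬ P (ratioPoint z) 0 ≈ 0#
        search (ratio ∷ _) (here e)  = _ , ratio , e
        search (_ ∷ rs)    (there e) = search rs e
      ... | yes all = contradiction (P≈0⇒ι≈0 0<t (many-doubleRoots⇒zero (List.map ratioPoint zs)
          (AllPairs-map ratioPoint (λ rz rz′ z≉z′ e → z≉z′ (ratioPoint-injective rz rz′ e)) ratios zs!)
          (≡.subst (λ l → d ≤ l ℕ.* 2) (≡.sym (List.length-map ratioPoint zs)) d≤2∣zs∣) P-poly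
          (All.map⁺ (All.zipWith (λ (P₀ , ratio) → P₀ , critical-P₁ C₂≉0 (ratioPoint-critical ratio 0<t)) (all , ratios))))) ιn≉0
        where
        P≈0⇒ι≈0 : 0 < t → (∀ x i → P x i ≈ 0#) → ι n ≈ 0#
        P≈0⇒ι≈0 (s≤s {n = t-1} z≤n) P≈0 = powerSum≈0⇒ι≈0 t-1 c≉0 P≈0

      private
        α≉0 : ¬ α ≈ 0#
        α≉0 α≈0 = let (z , _ , P₀≉0) = nonroot-ratio in
          P₀≉0 (trans (P≈αG² (ratioPoint z) 0 (s≤s z≤n)) (trans (*-congʳ α≈0) (zeroˡ _)))

        2<4 = ℕ.s≤s (ℕ.s≤s (ℕ.s≤s (z≤n {1})))
        3<4 = ℕ.s≤s (ℕ.s≤s (ℕ.s≤s (ℕ.s≤s (z≤n {0}))))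
        2# = 1# + 1#

      -- Expanding P = α G² at a zero x of G to order 3 gives the value of G″/G′ at x.
      solution-ODE : ∀ {x} → Solution x → C₂ * (x * (c - x)) * (2# * G x 2) ≈ C₃ * (c - x - x) * G x 1
      solution-ODE {x} sol = *-cancelˡ-≉0 (*-≉0 α≉0 g₁≉0) (begin
        α * g₁ * (C₂ * (x * y) * (2# * g₂))
          ≈⟨ solve 5 (λ α g₁ g₂ m g₃ → α :* g₁ :* (m :* (:2 :* g₂))
               := m :* (α :* (:2 :* (:0 :* g₃ :+ g₁ :* g₂)))) refl α g₁ g₂ (C₂ * (x * y)) g₃ ⟩
        C₂ * (x * y) * (α * (2# * (0# * g₃ + g₁ * g₂)))
          ≈⟨ *-congˡ (*-congˡ (*-congˡ (+-congʳ (*-congʳ g₀≈0)))) ⟨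
        C₂ * (x * y) * (α * sq (G x) 3)
          ≈⟨ *-congˡ (P≈αG² x 3 3<4) ⟨
        C₂ * (x * y) * P x 3
          ≈⟨ critical-P₂-P₃ C₂≉0 crit ⟩
        C₃ * (y - x) * P x 2
          ≈⟨ *-congˡ P₂ ⟩
        C₃ * (y - x) * (α * (g₁ * g₁))
          ≈⟨ solve 3 (λ α g₁ k → k :* (α :* (g₁ :* g₁)) := α :* g₁ :* (k :* g₁)) refl α g₁ (C₃ * (y - x)) ⟩
        α * g₁ * (C₃ * (y - x) * g₁) ∎)
        where
        y = c - x
        g₁ = G x 1
        g₂ = G x 2
        g₃ = G x 3
        crit = solution-critical 0<t sol
        g₀≈0 : G x 0 ≈ 0#
        g₀≈0 with G x 0 ≟ 0#
        ... | yes e   = e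
        ... | no g₀≉0 = contradiction (trans (sym (P≈αG² x 0 (s≤s z≤n))) (solution-root sol)) (*-≉0 α≉0 (*-≉0 g₀≉0 g₀≉0))
        P₂ : P x 2 ≈ α * (g₁ * g₁)
        P₂ = begin
          P x 2                                ≈⟨ P≈αG² x 2 2<4 ⟩
          α * (2# * (G x 0 * g₂) + g₁ * g₁)    ≈⟨ *-congˡ (+-congʳ (*-congˡ (*-congʳ g₀≈0))) ⟩
          α * (2# * (0# * g₂) + g₁ * g₁)
            ≈⟨ solve 3 (λ α g₁ g₂ → α :* (:2 :* (:0 :* g₂) :+ g₁ :* g₁) := α :* (g₁ :* g₁)) refl α g₁ g₂ ⟩
          α * (g₁ * g₁)                        ∎
        g₁≉0 : ¬ g₁ ≈ 0#
        g₁≉0 g₁≈0 = critical-P₂≉0 C₂≉0 crit (trans P₂ (trans (*-congˡ (trans (*-congʳ g₁≈0) (zeroˡ g₁))) (zeroʳ α)))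

      private
        -- `E` expands C(n,2) X (c - X) G″ + C(n,3) (2X - c) G′, the expression that `solution-ODE`
        -- makes vanish at every solution.
        G″ E : Carrier → Seq
        G″ x = derivative (derivative (G x))
        E x i = C₂ * lin x 1# (lin (c - x) (- 1#) (G″ x)) i + C₃ * lin (- c + 2# * x) 2# (derivative (G x)) i

      Poly-∏ : ∀ rs → Poly (suc (length rs)) (∏ rs)
      Poly-∏ []       = Poly-const 1#
      Poly-∏ (r ∷ rs) = Poly-resp (λ x → lin-cong (solve 2 (λ r x → (:- r) :+ :1 :* x := x :- r) refl r x) refl (λ _ → refl))
        (Poly-lin (- r) 1# (Poly-∏ rs))

      -- The factors X and c - X restore the two degrees lost in G″, and 2X - c the one lost in G′.
      Poly-E : 2 ≤ length xs → Poly (suc (length xs)) E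
      Poly-E 2≤ = go (length xs) 2≤ (Poly-∏ xs)
        where
        go : ∀ l → 2 ≤ l → Poly (suc l) G → Poly (suc l) E
        go (suc (suc l)) _ G-poly = Poly-+
          (Poly-scale C₂ (Poly-X* (Poly-c-X* c (Poly-derivative (Poly-derivative G-poly)))))
          (Poly-scale C₃ (Poly-lin (- c) 2# (Poly-derivative G-poly)))
        go 1 (s≤s ())

      E-root : ∀ {x} → Solution x → Root E x
      E-root {x} sol = begin
        C₂ * (x * ((c - x) * (1# * (2# * g₂)))) + C₃ * ((- c + 2# * x) * (1# * g₁))
          ≈⟨ solve 6 (λ c x m k g₁ g₂ → m :* (x :* ((c :- x) :* (:1 :* (:2 :* g₂)))) :+ k :* (((:- c) :+ :2 :* x) :* (:1 :* g₁))
               := m :* (x :* (c :- x)) :* (:2 :* g₂) :- k :* (c :- x :- x) :* g₁) refl c x C₂ C₃ g₁ g₂ ⟩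
        C₂ * (x * (c - x)) * (2# * g₂) - C₃ * (c - x - x) * g₁
          ≈⟨ x≈y⇒x-y≈0 (solution-ODE sol) ⟩
        0# ∎
        where
        g₁ = G x 1
        g₂ = G x 2

      -- E vanishes at the zeros of G and has degree at most deg G, so E = λ G. At a zero of G′
      -- that is not a zero of G, comparing E′ = λ G′ = 0 with P = α G² leaves this relation.
      C₂+2C₃≈0 : 2 ≤ length xs → C₂ + 2# * C₃ ≈ 0#
      C₂+2C₃≈0 2≤∣xs∣ = xy≈0⇒y≈0 2≉0 (xy≈0⇒y≈0 (*-≉0 (ratioPoint-asymmetric ratio) g₂≉0) (begin
        -- As g₁ = 0, the coefficient of ε in E at x is 6 C₂ x y g₃ + 2 (C₂ - C₃) (y - x) g₂, and
        -- `relation` turns its first term into 6 C₃ (y - x) g₂.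
        (y - x) * g₂ * (2# * (C₂ + 2# * C₃))
          ≈⟨ solve 5 (λ c x m k g₂ → (c :- x :- x) :* g₂ :* (:2 :* (m :+ :2 :* k))
               := :6 :* (k :* (c :- x :- x) :* g₂) :+ (:2 :* m :* (c :- x :- x) :* g₂ :- :2 :* (k :* (c :- x :- x) :* g₂))) refl c x C₂ C₃ g₂ ⟩
        ι 6 * (C₃ * (y - x) * g₂) + (2# * C₂ * (y - x) * g₂ - 2# * (C₃ * (y - x) * g₂))
          ≈⟨ +-congʳ (*-congˡ relation) ⟨
        ι 6 * (C₂ * (x * y) * g₃) + (2# * C₂ * (y - x) * g₂ - 2# * (C₃ * (y - x) * g₂))
          ≈⟨ solve 6 (λ c x m k g₂ g₃ → :6 :* (m :* (x :* (c :- x)) :* g₃) :+ (:2 :* m :* (c :- x :- x) :* g₂ :- :2 :* (k :* (c :- x :- x) :* g₂))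
               := m :* (x :* ((c :- x) :* (:2 :* (:3 :* g₃)) :+ (:- :1) :* (:1 :* (:2 :* g₂)))
                        :+ :1 :* ((c :- x) :* (:1 :* (:2 :* g₂))))
                  :+ k :* (((:- c) :+ :2 :* x) :* (:2 :* g₂) :+ :2 :* (:1 :* :0))) refl c x C₂ C₃ g₂ g₃ ⟩
        C₂ * (x * (y * (2# * (ι 3 * g₃)) + - 1# * (1# * (2# * g₂))) + 1# * (y * (1# * (2# * g₂))))
          + C₃ * ((- c + 2# * x) * (2# * g₂) + 2# * (1# * 0#))
          ≈⟨ +-congˡ (*-congˡ (+-congˡ (*-congˡ (*-congˡ g₁≈0)))) ⟨
        E x 1
          ≈⟨ proj₂ λG x 1 ⟩
        proj₁ λG * G x 1
          ≈⟨ trans (*-congˡ g₁≈0) (zeroʳ _) ⟩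
        0# ∎))
        where
        z = proj₁ nonroot-ratio
        ratio = proj₁ (proj₂ nonroot-ratio)
        x = ratioPoint z
        y = c - x
        g₀ = G x 0
        g₁ = G x 1
        g₂ = G x 2
        g₃ = G x 3
        crit = ratioPoint-critical ratio 0<t
        λG : ∃ λ b → ∀ x i → E x i ≈ b * G x i
        λG = factor-roots xs xs! ℕ.≤-refl (Poly-E 2≤∣xs∣) (All.map E-root solutions)
        g₀≉0 : ¬ g₀ ≈ 0#
        g₀≉0 e = proj₂ (proj₂ nonroot-ratio) (begin
          P x 0            ≈⟨ P≈αG² x 0 (s≤s z≤n) ⟩
          α * (g₀ * g₀)    ≈⟨ *-congˡ (trans (*-congʳ e) (zeroˡ g₀)) ⟩
          α * 0#           ≈⟨ zeroʳ α ⟩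
          0#               ∎)
        2αg₀≉0 : ¬ 2# * (α * g₀) ≈ 0#
        2αg₀≉0 = *-≉0 2≉0 (*-≉0 α≉0 g₀≉0)
        g₁≈0 : g₁ ≈ 0#
        g₁≈0 = xy≈0⇒y≈0 2αg₀≉0 (begin
          2# * (α * g₀) * g₁    ≈⟨ solve 3 (λ α g₀ g₁ → :2 :* (α :* g₀) :* g₁ := α :* (:2 :* (g₀ :* g₁))) refl α g₀ g₁ ⟩
          α * (2# * (g₀ * g₁))  ≈⟨ P≈αG² x 1 (s≤s (s≤s z≤n)) ⟨
          P x 1                 ≈⟨ critical-P₁ C₂≉0 crit ⟩
          0#                    ∎)
        P₂ : P x 2 ≈ 2# * (α * g₀) * g₂
        P₂ = begin
          P x 2                                ≈⟨ P≈αG² x 2 2<4 ⟩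
          α * (2# * (g₀ * g₂) + g₁ * g₁)       ≈⟨ *-congˡ (+-congˡ (*-congʳ g₁≈0)) ⟩
          α * (2# * (g₀ * g₂) + 0# * g₁)
            ≈⟨ solve 4 (λ α g₀ g₁ g₂ → α :* (:2 :* (g₀ :* g₂) :+ :0 :* g₁) := :2 :* (α :* g₀) :* g₂) refl α g₀ g₁ g₂ ⟩
          2# * (α * g₀) * g₂                   ∎
        P₃ : P x 3 ≈ 2# * (α * g₀) * g₃
        P₃ = begin
          P x 3                                ≈⟨ P≈αG² x 3 3<4 ⟩
          α * (2# * (g₀ * g₃ + g₁ * g₂))       ≈⟨ *-congˡ (*-congˡ (+-congˡ (*-congʳ g₁≈0))) ⟩
          α * (2# * (g₀ * g₃ + 0# * g₂))
            ≈⟨ solve 4 (λ α g₀ g₂ g₃ → α :* (:2 :* (g₀ :* g₃ :+ :0 :* g₂)) := :2 :* (α :* g₀) :* g₃) refl α g₀ g₂ g₃ ⟩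
          2# * (α * g₀) * g₃                   ∎
        g₂≉0 : ¬ g₂ ≈ 0#
        g₂≉0 e = critical-P₂≉0 C₂≉0 crit (trans P₂ (trans (*-congˡ e) (zeroʳ _)))
        -- Where G′ vanishes, P₂ and P₃ are the same multiple 2 α g₀ of g₂ and g₃, so
        -- `critical-P₂-P₃` passes to G.
        relation : C₂ * (x * y) * g₃ ≈ C₃ * (y - x) * g₂
        relation = *-cancelˡ-≉0 2αg₀≉0 (begin
          2# * (α * g₀) * (C₂ * (x * y) * g₃)
            ≈⟨ solve 3 (λ w m g → w :* (m :* g) := m :* (w :* g)) refl (2# * (α * g₀)) (C₂ * (x * y)) g₃ ⟩
          C₂ * (x * y) * (2# * (α * g₀) * g₃)  ≈⟨ *-congˡ P₃ ⟨
          C₂ * (x * y) * P x 3                 ≈⟨ critical-P₂-P₃ C₂≉0 crit ⟩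
          C₃ * (y - x) * P x 2                 ≈⟨ *-congˡ P₂ ⟩
          C₃ * (y - x) * (2# * (α * g₀) * g₂)
            ≈⟨ solve 3 (λ w m g → w :* (m :* g) := m :* (w :* g)) refl (2# * (α * g₀)) (C₃ * (y - x)) g₂ ⟨
          2# * (α * g₀) * (C₃ * (y - x) * g₂)  ∎)

  -- The pairs counted by r as a list of solutions.

  module _ (k : ℕ) (c : Carrier) where

    private
      Pair : Carrier × Carrier → Set _
      Pair (x , y) = (Powers k x × Powers k y) × x + y ≈ c
      pair? : Decidable Pair
      pair? (x , y) = (powers? k x ×-dec powers? k y) ×-dec (x + y ≟ c)
      pairs : List (Carrier × Carrier)
      pairs = List.filter pair? (List.cartesianProduct elements elements)
      pairs-valid : All Pair pairs
      pairs-valid = All.all-filter pair? (List.cartesianProduct elements elements)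

    solutionList : List Carrier
    solutionList = List.map proj₁ pairs

    length-solutionList : length solutionList ≡ r (powers? k) c
    length-solutionList = List.length-map proj₁ pairs

    y≈c-x : ∀ {x y} → x + y ≈ c → y ≈ c - x
    y≈c-x {x} {y} e = trans (solve 2 (λ x y → y := x :+ y :- x) refl x y) (+-congʳ e)

    -- Since y = c - x, distinct pairs have distinct first components.
    solutionList-distinct : Distinct solutionList
    solutionList-distinct = AllPairs-map {R = λ (x , y) (x′ , y′) → ¬ (x ≈ x′ × y ≈ y′)} {P = Pair} proj₁
      (λ (_ , e) (_ , e′) ≉ x≈x′ → ≉ (x≈x′ , trans (y≈c-x e) (trans (+-congˡ (-‿cong x≈x′)) (sym (y≈c-x e′)))))
      pairs-valid
      (AllPairs.filter⁺ pair? (UniqueSetoid.cartesianProduct⁺ setoid setoid elements-distinct elements-distinct))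

    solutionList-solutions : ∀ {t} → t ℕ.* k ≡ pred q → (c≉0 : ¬ c ≈ 0#) → All (Solution c t c≉0) solutionList
    solutionList-solutions {t} tk≡q-1 c≉0 = All.map⁺ (All.map
      (λ ((x∈A , y∈A) , e) → Powers⇒^t≈1 {t} {k} tk≡q-1 x∈A
                           , trans (^-congˡ t (sym (y≈c-x e))) (Powers⇒^t≈1 {t} {k} tk≡q-1 y∈A))
      pairs-valid)

  -- Exclusion of exponents and the bound on the number of solutions.

  -- The fixed points of x ↦ x^M form a subfield containing the generators, hence are everything.
  generators-fixed⇒q≤ : ∀ {k} M → 2 ≤ M → Additive M → (∀ x → x ∈ Adjoin (Powers k)) →
                        (∀ {x} → Powers k x → x ^ M ≈ x) → q ≤ M
  generators-fixed⇒q≤ 1 (s≤s ()) _ _ _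
  generators-fixed⇒q≤ (suc (suc M)) _ additive generates fixed = fixed-by-power⇒q≤ M
    (λ x → Adjoin-least (fixed-isSubfield (suc M) additive) fixed (generates x))

  module _ {p} (p-prime : Prime p) (ιp≈0 : Characteristic p)
           {t k} (tk≡q-1 : t ℕ.* k ≡ pred q) (generates : ∀ x → x ∈ Adjoin (Powers k))
           {c} (c≉0 : ¬ c ≈ 0#) {xs} (xs! : Distinct xs) (solutions : All (Solution c t c≉0) xs)
           where

    open PrimeCharacteristic p-prime ιp≈0

    -- That many solutions force m = 1, so n = p^s is an additive exponent fixing A and therefore
    -- the whole field, which gives q ≤ n.
    no-additive-exponent : ∀ {n} s m → n ≡ p ℕ.^ s ℕ.* m → ¬ p ∣ m → 2 ≤ p ℕ.^ s → n < q →
      (∀ {x} → x ^ t ≈ 1# → x ^ n ≈ x) → ¬ (((∃ λ j → m ≡ suc (j ℕ.* 2)) × m ≤ length xs) ⊎ suc m ≤ length xs)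
    no-additive-exponent {n} s m ≡.refl p∤m 2≤M n<q fixed bound = ℕ.<⇒≱ n<q
      (ℕ.≤-trans (generators-fixed⇒q≤ {k} M 2≤M additive generates
        (λ {x} x∈A → trans (reflexive (≡.cong (x ^_) (≡.sym M*m≡M))) (fixed {x} (Powers⇒^t≈1 {t} {k} tk≡q-1 x∈A))))
        (ℕ.≤-reflexive (≡.sym M*m≡M)))
      where
      M = p ℕ.^ s
      additive = frobenius p-prime ιp≈0 s
      m≡1 = additive-power⇒linear M m additive c≉0 (∤⇒ι≉0 p∤m) xs xs!
        (All.map (λ (x^t≈1 , y^t≈1) → fixed x^t≈1 , fixed y^t≈1) solutions) bound
      M*m≡M : M ℕ.* m ≡ M
      M*m≡M = ≡.trans (≡.cong (M ℕ.*_) m≡1) (ℕ.*-identityʳ M)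

  x^[1+t]≈x : ∀ {x t} → x ^ t ≈ 1# → x ^ suc t ≈ x
  x^[1+t]≈x x^t≈1 = trans (*-congˡ x^t≈1) (*-identityʳ _)

  x^[1+2t]≈x : ∀ {x} t → x ^ t ≈ 1# → x ^ suc (2 ℕ.* t) ≈ x
  x^[1+2t]≈x {x} t x^t≈1 = x^[1+t]≈x {x} {2 ℕ.* t} (begin
    x ^ (2 ℕ.* t)   ≡⟨ ≡.cong (x ^_) (ℕ.*-comm 2 t) ⟩
    x ^ (t ℕ.* 2)   ≈⟨ ^-assocʳ x t 2 ⟨
    (x ^ t) ^ 2     ≈⟨ ^-congˡ 2 x^t≈1 ⟩
    1# ^ 2          ≈⟨ 1^n≈1 2 ⟩
    1#              ∎)

  length≤1+length-filter-≉ : ∀ y zs → Distinct zs → length zs ≤ suc (length (List.filter (¬? ∘ (_≟ y)) zs))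
  length≤1+length-filter-≉ y zs zs! = ℕ.≤-trans (ℕ.≤-reflexive (length-filter-split (_≟ y) zs))
    (ℕ.+-monoˡ-≤ _ (all-equal⇒length≤1 (List.filter (_≟ y) zs) (AllPairs.filter⁺ (_≟ y) zs!) (All.all-filter (_≟ y) zs)))

  module _ {t k} (tk≡q-1 : t ℕ.* k ≡ pred q) (5≤t : 5 ≤ t) (t≤∣A∣ : t ≤ length (powerList k))
           {c} (c≉0 : ¬ c ≈ 0#) {xs} (xs! : Distinct xs) (solutions : All (Solution c t c≉0) xs)
           (t≤2∣xs∣ : t ≤ length xs ℕ.* 2)
           (2≉0 : ¬ 1# + 1# ≈ 0#) (ιn≉0 : ¬ ι (suc t) ≈ 0#) (C₂≉0 : ¬ ι (suc t C 2) ≈ 0#)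
           where

    private
      zs₁ zs₂ : List Carrier
      zs₁ = List.filter (¬? ∘ (_≟ 1#)) (powerList k)
      zs₂ = List.filter (¬? ∘ (_≟ - 1#)) zs₁
      zs₁! = AllPairs.filter⁺ (¬? ∘ (_≟ 1#)) (powerList-distinct k)
      zs₂! = AllPairs.filter⁺ (¬? ∘ (_≟ - 1#)) zs₁!
      t≤1+∣zs₁∣ = ℕ.≤-trans t≤∣A∣ (length≤1+length-filter-≉ 1# (powerList k) (powerList-distinct k))
      t≤2+∣zs₂∣ = ℕ.≤-trans t≤1+∣zs₁∣ (s≤s (length≤1+length-filter-≉ (- 1#) zs₁ zs₁!))
      zs₁-roots : All (λ z → z ^ t ≈ 1# × ¬ z ≈ 1#) zs₁
      zs₁-roots = All.zipWith id
        ( All.filter⁺ (¬? ∘ (_≟ 1#)) (All.map (Powers⇒^t≈1 {t} {k} tk≡q-1) (All.all-filter (powers? k) elements))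
        , All.all-filter (¬? ∘ (_≟ 1#)) (powerList k))
      2≤∣xs∣ : 2 ≤ length xs
      2≤∣xs∣ = ℕ.*-cancelʳ-≤ 2 (length xs) 2 (ℕ.≤-trans (ℕ.n≤1+n 4) (ℕ.≤-trans 5≤t t≤2∣xs∣))
      0<t = ℕ.≤-trans (s≤s z≤n) 5≤t

    -- For even t the degree of P is at most t, and removing 1 and -1 from A leaves at least t - 2
    -- ratios. For odd t the degree may be t + 1, but -1 is not a t-th root of unity, so only 1 is
    -- removed.
    ratio-sum : ι (suc t C 2) + (1# + 1#) * ι (suc t C 3) ≈ 0#
    ratio-sum with parity t
    ... | inj₁ (j , ≡.refl) = C₂+2C₃≈0 c t c≉0 0<t 2≉0 ιn≉0 C₂≉0 xs! solutions zs₂!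
          (All.zipWith (λ ((z^t , z≉1) , z≉-1) → z^t , z≉1 , z≉-1)
            (All.filter⁺ (¬? ∘ (_≟ - 1#)) zs₁-roots , All.all-filter (¬? ∘ (_≟ - 1#)) zs₁))
          (Poly-powerSum-odd c c j) (s≤s t≤2∣xs∣) (1+t≤2l (length zs₂) 5≤t t≤2+∣zs₂∣) 2≤∣xs∣
    ... | inj₂ (j , ≡.refl) = C₂+2C₃≈0 c t c≉0 0<t 2≉0 ιn≉0 C₂≉0 xs! solutions zs₁!
          (All.map (λ (z^t , z≉1) → z^t , z≉1 , λ z≈-1 → 2≉0 (begin
              1# + 1#          ≈⟨ +-congʳ (trans (sym (trans (^-congˡ t z≈-1) (-1^odd≈-1 j))) z^t) ⟨
              - 1# + 1#        ≈⟨ -‿inverseˡ 1# ⟩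
              0#               ∎)) zs₁-roots)
          -- Since t = 2 j + 1 is odd, t ≤ 2 |xs| improves to t + 1 ≤ 2 |xs|, which absorbs the
          -- larger degree.
          (Poly-powerSum c c (suc t)) (s≤s (ℕ.*-monoˡ-≤ 2 (ℕ.*-cancelʳ-< 2 j (length xs) t≤2∣xs∣)))
          (1+t≤2l (length zs₁) (ℕ.≤-trans 5≤t (ℕ.n≤1+n t)) (s≤s t≤1+∣zs₁∣)) 2≤∣xs∣

  module _ {p} (p-prime : Prime p) (ιp≈0 : Characteristic p) (p∣q : p ∣ q)
           {t k} (tk≡q-1 : t ℕ.* k ≡ pred q) (3≤k : 3 ≤ k) (5≤t : 5 ≤ t) (t≤∣A∣ : t ≤ length (powerList k))
           (generates : ∀ x → x ∈ Adjoin (Powers k))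
           {c} (c≉0 : ¬ c ≈ 0#) {xs} (xs! : Distinct xs) (solutions : All (Solution c t c≉0) xs)
           where

    private
      open PrimeCharacteristic p-prime ιp≈0

      -- Here k ≥ 3 enters: 2 t + 1 ≤ 3 t ≤ k t = q - 1.
      1+2t≤q-1 : suc (2 ℕ.* t) ≤ pred q
      1+2t≤q-1 = ℕ.≤-trans (ℕ.+-monoˡ-≤ (2 ℕ.* t) (ℕ.≤-trans (s≤s z≤n) 5≤t))
        (ℕ.≤-trans (ℕ.≤-reflexive (ℕ.*-comm 3 t)) (ℕ.≤-trans (ℕ.*-monoʳ-≤ t 3≤k) (ℕ.≤-reflexive tk≡q-1)))

      1+q-1≡q : suc (pred q) ≡ q
      1+q-1≡q = suc-pred (ℕ.≤-trans (s≤s z≤n) 1+2t≤q-1)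

      1+2t<q : suc (2 ℕ.* t) < q
      1+2t<q = ℕ.≤-trans (s≤s 1+2t≤q-1) (ℕ.≤-reflexive 1+q-1≡q)

      p∤t : ¬ p ∣ t
      p∤t p∣t = contradiction (∣1⇒≡1 (∣m+n∣m⇒∣n {p} {pred q} {1}
        (≡.subst (p ∣_) (≡.trans (≡.sym 1+q-1≡q) (ℕ.+-comm 1 (pred q))) p∣q)
        (≡.subst (p ∣_) tk≡q-1 (∣m⇒∣m*n k p∣t)))) (ℕ.>⇒≢ (prime≥2 p-prime))

    -- Otherwise `no-additive-exponent` applies to the exponent t + 1, which fixes A pointwise.
    p∤1+t : t ≤ length xs ℕ.* 2 → ¬ p ∣ suc t
    p∤1+t t≤2∣xs∣ p∣1+t with prime-power-part p-prime (suc t) (s≤s z≤n)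
    ... | s , m , 1+t≡ , p∤m = no-additive-exponent p-prime ιp≈0 {t} {k} tk≡q-1 generates c≉0 xs! solutions s m 1+t≡ p∤m
          (ℕ.≤-trans (prime≥2 p-prime) p≤M) (ℕ.≤-<-trans (s≤s (ℕ.m≤m+n t _)) 1+2t<q) (λ {x} → x^[1+t]≈x {x} {t}) (bound (parity m))
      where
      p≤M = p≤p^s {s = s} p-prime 1+t≡ p∤m p∣1+t
      bound : (∃ λ j → m ≡ j ℕ.* 2) ⊎ (∃ λ j → m ≡ suc (j ℕ.* 2)) →
              ((∃ λ j → m ≡ suc (j ℕ.* 2)) × m ≤ length xs) ⊎ suc m ≤ length xs
      bound (inj₂ m-odd) = inj₁ (m-odd , odd-cofactor-≤ 1+t≡ (ℕ.≤-trans (prime≥2 p-prime) p≤M) t≤2∣xs∣)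
      bound (inj₁ (zero , m≡0)) = contradiction (≡.subst (p ∣_) (≡.sym m≡0) (divides 0 ≡.refl)) p∤m
      -- An even m prime to p excludes p = 2, so M ≥ p ≥ 3.
      bound (inj₁ (suc j , m≡)) = inj₂ (even-cofactor-< 1+t≡
        (ℕ.≤-trans (ℕ.≤∧≢⇒< (prime≥2 p-prime) (λ { ≡.refl → p∤m (divides (suc j) m≡) })) p≤M)
        (≡.subst (2 ≤_) (≡.sym m≡) (s≤s (s≤s z≤n))) t≤2∣xs∣)

    -- If it failed, `ratio-sum` would make the p-part of 2 t + 1 at least 5, and
    -- `no-additive-exponent` would apply to the exponent 2 t + 1.
    few-solutions : length xs ℕ.* 2 < t
    few-solutions with length xs ℕ.* 2 ℕ.<? t
    ... | yes 2∣xs∣<t = 2∣xs∣<t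
    ... | no  2∣xs∣≮t = contradiction (bound (parity m))
          (no-additive-exponent p-prime ιp≈0 {t} {k} tk≡q-1 generates c≉0 xs! solutions s m 1+2t≡ p∤m
            (ℕ.≤-trans (ℕ.m≤n+m 2 3) 5≤M) 1+2t<q (λ {x} → x^[1+2t]≈x {x} t))
      where
      t≤2∣xs∣ = ℕ.≮⇒≥ 2∣xs∣≮t
      p∤[1+t]*t : ¬ p ∣ suc t ℕ.* t
      p∤[1+t]*t p∣ with euclidsLemma (suc t) t p-prime p∣
      ... | inj₁ p∣1+t = p∤1+t t≤2∣xs∣ p∣1+t
      ... | inj₂ p∣t   = p∤t p∣t
      -- One of t and t + 1 is even, while p divides neither.
      p≢2 : ¬ p ≡ 2
      p≢2 ≡.refl with parity t
      ... | inj₁ (j , t≡) = p∤t (divides j t≡)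
      ... | inj₂ (j , t≡) = p∤1+t t≤2∣xs∣ (divides (suc j) (≡.cong suc t≡))
      p∤C₂ : ¬ p ∣ suc t C 2
      p∤C₂ p∣C₂ = p∤[1+t]*t (≡.subst (p ∣_) (2*[1+t]C2≡[1+t]*t t) (∣n⇒∣m*n 2 p∣C₂))
      p∣C₂+2C₃ : p ∣ suc t C 2 ℕ.+ 2 ℕ.* (suc t C 3)
      p∣C₂+2C₃ = ι≈0⇒∣ (trans
        (trans (×-homo-+ 1# (suc t C 2) (2 ℕ.* (suc t C 3))) (+-congˡ (ι-* 2 (suc t C 3))))
        (ratio-sum {t} {k} tk≡q-1 5≤t t≤∣A∣ c≉0 xs! solutions t≤2∣xs∣
          (∤⇒ι≉0 {2} λ p∣2 → p≢2 (ℕ.≤-antisym (∣⇒≤ p∣2) (prime≥2 p-prime)))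
          (∤⇒ι≉0 (p∤1+t t≤2∣xs∣)) (∤⇒ι≉0 p∤C₂)))
      factorisation = prime-power-part p-prime (suc (2 ℕ.* t)) (s≤s z≤n)
      s = proj₁ factorisation
      m = proj₁ (proj₂ factorisation)
      1+2t≡ = proj₁ (proj₂ (proj₂ factorisation))
      p∤m = proj₂ (proj₂ (proj₂ factorisation))
      5≤M = 5≤p^s {s = s} p-prime p≢2 p∤[1+t]*t p∣C₂+2C₃ (6*[C2+2C3]≡[1+t]*t*[1+2t] t) 1+2t≡ p∤m
      bound : (∃ λ j → m ≡ j ℕ.* 2) ⊎ (∃ λ j → m ≡ suc (j ℕ.* 2)) →
              ((∃ λ j → m ≡ suc (j ℕ.* 2)) × m ≤ length xs) ⊎ suc m ≤ length xs
      bound (inj₁ (j , m≡)) = contradiction (≡.trans 1+2t≡ (≡.cong (p ℕ.^ s ℕ.*_) m≡)) (1+2t-odd t j (p ℕ.^ s))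
      bound (inj₂ m-odd)    = inj₁ (m-odd , cofactor-≤ 1+2t≡ 5≤M t≤2∣xs∣)

-- The bound for r, with t identified as the order of the subgroup.

theorem1p7 : ∀ {a ℓ₁ ℓ₂} (p f k : ℕ) → Prime p → 1 ≤ f →
    (F : FiniteField a ℓ₁ ℓ₂ (p ℕ.^ f)) →
    let open FiniteField F in
    k ∣ (p ℕ.^ f ∸ 1) →
    (∀ x → x ∈ Adjoin (Powers k)) →
    3 ≤ k →
    5 ≤ ∣ powers? k ∣ →
    ∀ (c : Carrier) → ¬ (c ≈ 0#) → 2 ℕ.* r (powers? k) c < ∣ powers? k ∣
theorem1p7 p (suc f) k@(suc k-1) p-prime (s≤s _) F (divides t q-1≡tk) generates 3≤k@(s≤s _) 5≤∣A∣ c c≉0 =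
  ≡.subst₂ _<_ (≡.trans (ℕ.*-comm (length (solutionList k c)) 2) (≡.cong (2 ℕ.*_) (length-solutionList k c))) t≡∣A∣
    (few-solutions p-prime (characteristic p (suc f) ≡.refl) (m∣m*n (p ℕ.^ f)) {t} {k} tk≡q-1 3≤k
      (≡.subst (5 ≤_) (≡.sym t≡∣A∣) 5≤∣A∣) t≤∣A∣ generates c≉0
      (solutionList-distinct k c) (solutionList-solutions k c {t} tk≡q-1 c≉0))
  where
  open FiniteField F using (∣_∣; powers?; elements)
  open FieldTheory F
  tk≡q-1 = ≡.sym q-1≡tk
  t≤∣A∣ = t≤∣Powers∣ t k-1 tk≡q-1
  ∣A∣≤t : ∀ t → t ℕ.* k ≡ pred (p ℕ.^ suc f) → ∣ powers? k ∣ ≤ t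
  ∣A∣≤t (suc t) tk≡q-1 = ∣Powers∣≤t t k tk≡q-1
  -- A zero quotient would mean q ≤ 1, against 5 ≤ |A| ≤ q.
  ∣A∣≤t zero 0≡q-1 = contradiction
    (ℕ.≤-trans (ℕ.pred-mono-≤ (ℕ.≤-trans 5≤∣A∣ (ℕ.≤-trans (List.length-filter (powers? k) elements) (ℕ.≤-reflexive length-elements))))
      (ℕ.≤-reflexive (≡.sym 0≡q-1))) λ ()
  t≡∣A∣ = ℕ.≤-antisym t≤∣A∣ (∣A∣≤t t tk≡q-1)
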